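{- Let $\mathcal{R}$ be a commutative ring containing $\mathbb{Q}$ and let $\phi(x)=\sum_{k\ge 0}\phi[k]\frac{x^k}{k!}\in\mathcal{R}[[x]]$ with $\phi[0]\neq 0$. Let $P_\phi(t,q)=\sum_{n\ge 1}p_n^{\phi}(q)\frac{t^n}{n!}$ with $$p_n^{\phi}(q)=\sum_{T} q^{\mathrm{pl}(T)}\prod_{v\in[n]}\phi\big[\,|T^{ -1}(v)|\,\big],$$ the sum being over all increasing rooted trees $T$ with vertex set $[n]$, and put $$F_\phi(t,q)=\phi(P_\phi(t,q))=\sum_{n\ge 0}f_n^{\phi}(q)\frac{t^n}{n!}.$$ Then $$F_\phi(t,q)=\frac{\partial P_\phi(u,q)}{\partial u}\Big|_{u=t/q}.$$ Equivalently, $f_n^{\phi}(q)=q^{ -n}p_{n+1}^{\phi}(q)$ for all $n\ge 0$.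
   Context: $[n]=\{1,\dots,n\}$. An increasing rooted tree on $[n]$ is a (non-plane) labelled rooted tree with vertex set $[n]$ whose labels increase along every path from the root to the leaves. $T^{ -1}(v)$ denotes the (possibly empty) set of children of the vertex $v$. The height of a vertex is the number of edges on the path from it to the root, and the path length $\mathrm{pl}(T)$ is the sum of the heights of all vertices of $T$. The series $F_\phi(t,q)$ is the generating function of $\phi$-forests of $\phi$-enriched increasing trees enumerated by path length. The identities are read in $\mathcal{R}[q,q^{ -1}][[t]]$. -}

module Defs where

open import Algebra.Bundles using (CommutativeRing)
open import Algebra.Bundles.Raw using (RawRing)
import Algebra.Definitions.RawSemiring as RawSemiringDefs
open import Data.Fin.Base using (Fin; toℕ; fromℕ<) renaming (_<_ to _<ᶠ_)
import Data.Fin.Properties as Fin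
open import Data.Integer.Base using (ℤ; +_; 0ℤ) renaming (_+_ to _+ℤ_)
import Data.Integer.Properties as ℤ
open import Data.List.Base using (List; []; _∷_; _++_; map; foldr; filter; length; allFin; cartesianProductWith)
open import Data.List.Membership.Propositional using (_∈_)
open import Data.List.Membership.Propositional.Properties using (∈-allFin; ∈-map⁺; ∈-filter⁺; ∈-cartesianProductWith⁺)
open import Data.List.Relation.Unary.All using ([]; _∷_)
import Data.List.Relation.Unary.All.Properties as All
open import Data.List.Relation.Unary.AllPairs using ([]; _∷_)
open import Data.List.Relation.Unary.Any using (here; there)
open import Data.List.Relation.Unary.Unique.Propositional using (Unique)
import Data.List.Relation.Unary.Unique.Propositional.Properties as Unique
import Data.List.Relation.Unary.All as AllBase
open import Data.Maybe.Base using (Maybe; just; nothing; _>>=_)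
import Data.Maybe.Properties as Maybe
open import Data.Nat.Base using (ℕ; zero; suc; _∸_; _!; _≤_; _<_)
import Data.Nat.Base as ℕ
import Data.Nat.ListAction as ℕ
import Data.Nat.Properties as ℕ
open import Data.Product.Base using (_×_; _,_; proj₁; proj₂; ∃)
open import Data.Rational.Base using (ℚ) renaming (_/_ to _/ℚ_)
open import Data.Vec.Base using (Vec; lookup) renaming ([] to []ᵛ; _∷_ to _∷ᵛ_)
open import Data.Vec.Properties using (∷-injective)
open import Level using (Level)
open import Relation.Binary.PropositionalEquality using (_≡_; refl; sym; cong; subst)
open import Relation.Nullary.Decidable using (Dec; yes; no; map′; _×-dec_; _→-dec_)

private
  variable
    n : ℕ

------------------------------------------------------------------------
-- The vertex set {1,…,n} is rendered as Fin n, with its usual order.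

-- `lookup T w ≡ just v` means that v is the parent of w.
ParentMap : ℕ → Set
ParentMap n = Vec (Maybe (Fin n)) n

-- The vertex (if any) reached from v by following k parent edges.
ancestor : ParentMap n → ℕ → Fin n → Maybe (Fin n)
ancestor T zero    v = just v
ancestor T (suc k) v = ancestor T k v >>= lookup T

-- As the root has no parent, the number of steps in `path v` is unique,
-- and so is the parentless vertex.
record IsRootedTree (T : ParentMap n) : Set where
  field
    root     : Fin n
    orphaned : lookup T root ≡ nothing
    path     : ∀ v → ∃ λ k → ancestor T k v ≡ just root

IsIncreasing : ParentMap n → Set
IsIncreasing T = ∀ k v w → ancestor T (suc k) w ≡ just v → v <ᶠ w

record IsIncreasingTree (T : ParentMap n) : Set where
  field
    isRootedTree : IsRootedTree T
    isIncreasing : IsIncreasing T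
  open IsRootedTree isRootedTree public

record IncreasingTree (n : ℕ) : Set where
  field
    parents          : ParentMap n
    isIncreasingTree : IsIncreasingTree parents
  open IsIncreasingTree isIncreasingTree public

  children : Fin n → List (Fin n)
  children v = filter (λ w → Maybe.≡-dec Fin._≟_ (lookup parents w) (just v)) (allFin n)

  height : Fin n → ℕ
  height v = proj₁ (path v)

  pathLength : ℕ
  pathLength = ℕ.sum (map height (allFin n))

open IncreasingTree public using (parents; isIncreasingTree; children; height; pathLength)

------------------------------------------------------------------------

private
  _≟ᵐ_ : (x y : Maybe (Fin n)) → Dec (x ≡ y)
  _≟ᵐ_ = Maybe.≡-dec Fin._≟_

  edges⇒increasing : (T : ParentMap n) → (∀ v w → lookup T w ≡ just v → v <ᶠ w) → IsIncreasing T
  edges⇒increasing T e zero    v w eq = e v w eq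
  edges⇒increasing T e (suc k) v w eq with ancestor T (suc k) w in eq′
  ... | just u = ℕ.<-trans (e v u eq) (edges⇒increasing T e k u w eq′)

  increasing? : (T : ParentMap n) → Dec (IsIncreasing T)
  increasing? T = map′ (edges⇒increasing T) (λ i → i 0)
    (Fin.all? λ v → Fin.all? λ w → (lookup T w ≟ᵐ just v) →-dec (v Fin.<? w))

  steps≤label : (T : ParentMap n) → IsIncreasing T → ∀ k {v w} → ancestor T k w ≡ just v → toℕ v ℕ.+ k ≤ toℕ w
  steps≤label T i zero    refl = ℕ.≤-reflexive (ℕ.+-identityʳ _)
  steps≤label T i (suc k) {v} {w} eq with ancestor T k w in eq′
  ... | just u = ℕ.≤-trans (ℕ.≤-reflexive (ℕ.+-suc (toℕ v) k))
                   (ℕ.≤-trans (ℕ.+-monoˡ-≤ k (i 0 v u eq)) (steps≤label T i k eq′))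

  reaches? : (T : ParentMap n) → IsIncreasing T → ∀ r v → Dec (∃ λ k → ancestor T k v ≡ just r)
  reaches? {n} T i r v = map′ (λ (k , eq) → toℕ k , eq) bounded
    (Fin.any? λ (k : Fin n) → ancestor T (toℕ k) v ≟ᵐ just r)
    where
    bounded : (∃ λ k → ancestor T k v ≡ just r) → ∃ λ (k : Fin n) → ancestor T (toℕ k) v ≡ just r
    bounded (k , eq) = fromℕ< k<n , subst (λ j → ancestor T j v ≡ just r) (sym (Fin.toℕ-fromℕ< k<n)) eq
      where
      k<n : k < n
      k<n = ℕ.≤-<-trans (ℕ.≤-trans (ℕ.m≤n+m k (toℕ r)) (steps≤label T i k eq)) (Fin.toℕ<n v)

  rootedTree? : (T : ParentMap n) → IsIncreasing T → Dec (IsRootedTree T)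
  rootedTree? T i = map′
    (λ (r , o , p) → record { root = r ; orphaned = o ; path = p })
    (λ t → IsRootedTree.root t , IsRootedTree.orphaned t , IsRootedTree.path t)
    (Fin.any? λ r → (lookup T r ≟ᵐ nothing) ×-dec Fin.all? (reaches? T i r))

increasingTree? : (T : ParentMap n) → Dec (IsIncreasingTree T)
increasingTree? T with increasing? T
... | no ¬i = no (λ t → ¬i (IsIncreasingTree.isIncreasing t))
... | yes i = map′ (λ t → record { isRootedTree = t ; isIncreasing = i })
                   IsIncreasingTree.isRootedTree (rootedTree? T i)

vectorsOver : ∀ {a} {A : Set a} → List A → (m : ℕ) → List (Vec A m)
vectorsOver xs zero    = []ᵛ ∷ []
vectorsOver xs (suc m) = cartesianProductWith _∷ᵛ_ xs (vectorsOver xs m)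

parentMaps : (n : ℕ) → List (ParentMap n)
parentMaps n = vectorsOver (nothing ∷ map just (allFin n)) n

selectTrees : List (ParentMap n) → List (IncreasingTree n)
selectTrees []       = []
selectTrees (T ∷ Ts) with increasingTree? T
... | yes t = record { parents = T ; isIncreasingTree = t } ∷ selectTrees Ts
... | no  _ = selectTrees Ts

increasingTrees : (n : ℕ) → List (IncreasingTree n)
increasingTrees n = selectTrees (parentMaps n)

-- The enumeration is exhaustive and without repetition (a tree being
-- determined by its parent map).

selectTrees-filter : (Ts : List (ParentMap n)) → map parents (selectTrees Ts) ≡ filter increasingTree? Ts
selectTrees-filter []       = refl
selectTrees-filter (T ∷ Ts) with increasingTree? T
... | yes _ = cong (T ∷_) (selectTrees-filter Ts)
... | no  _ = selectTrees-filter Ts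

private
  vectorsOver-complete : ∀ {a} {A : Set a} {xs : List A} → (∀ x → x ∈ xs) →
                         ∀ {m} (v : Vec A m) → v ∈ vectorsOver xs m
  vectorsOver-complete c []ᵛ       = here refl
  vectorsOver-complete c (x ∷ᵛ v) = ∈-cartesianProductWith⁺ _∷ᵛ_ (c x) (vectorsOver-complete c v)

  vectorsOver-unique : ∀ {a} {A : Set a} {xs : List A} → Unique xs → ∀ m → Unique (vectorsOver xs m)
  vectorsOver-unique u zero    = [] ∷ []
  vectorsOver-unique u (suc m) = Unique.cartesianProductWith⁺ _∷ᵛ_ ∷-injective u (vectorsOver-unique u m)

  possibleParents-complete : (x : Maybe (Fin n)) → x ∈ nothing ∷ map just (allFin n)
  possibleParents-complete nothing  = here refl
  possibleParents-complete (just v) = there (∈-map⁺ just (∈-allFin v))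

  possibleParents-unique : Unique (nothing ∷ map just (allFin n))
  possibleParents-unique {n} =
    All.map⁺ (AllBase.universal (λ _ ()) (allFin n)) ∷ Unique.map⁺ Maybe.just-injective (Unique.allFin⁺ n)

increasingTrees-complete : (T : IncreasingTree n) → parents T ∈ map parents (increasingTrees n)
increasingTrees-complete {n} T = subst (parents T ∈_) (sym (selectTrees-filter (parentMaps n)))
  (∈-filter⁺ increasingTree? (vectorsOver-complete possibleParents-complete (parents T)) (isIncreasingTree T))

increasingTrees-unique : (n : ℕ) → Unique (map parents (increasingTrees n))
increasingTrees-unique n = subst Unique (sym (selectTrees-filter (parentMaps n)))
  (Unique.filter⁺ increasingTree? (vectorsOver-unique possibleParents-unique n))

------------------------------------------------------------------------

1/_! : ℕ → ℚ
1/ n ! = _/ℚ_ (+ 1) (n !) {{n ℕ.!≢0}}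

-- A series in A[[t]] is its sequence of ordinary (not exponential)
-- coefficients.
module PowerSeries {a ℓ : Level} (A : RawRing a ℓ) where

  open RawRing A
  open RawSemiringDefs rawSemiring using (sum; _^_) renaming (_×_ to _·_)

  Series : Set a
  Series = ℕ → Carrier

  series : RawRing a ℓ
  series = record
    { Carrier = Series
    ; _≈_     = λ f g → ∀ n → f n ≈ g n
    ; _+_     = λ f g n → f n + g n
    ; _*_     = λ f g n → sum {suc n} (λ i → f (toℕ i) * g (n ∸ toℕ i))
    ; -_      = λ f n → - f n
    ; 0#      = λ _ → 0#
    ; 1#      = λ { zero → 1# ; (suc _) → 0# }
    }

  private
    module S where
      open RawRing series public
      open RawSemiringDefs (RawRing.rawSemiring series) public

  infix 4 _≋_
  _≋_ : Series → Series → Set ℓ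
  _≋_ = S._≈_

  -- f(g(t)), meaningful only when g has zero constant term: then g^k has
  -- no terms below t^k, so the coefficient of tⁿ in Σ_k f_k g^k only
  -- involves k ≤ n.
  compose : Series → Series → Series
  compose f g n = sum {suc n} (λ k → f (toℕ k) * (g S.^ toℕ k) n)

  derivative : Series → Series
  derivative f n = suc n · f (suc n)

  -- f(u) at u = c t.
  dilate : Carrier → Series → Series
  dilate c f n = c ^ n * f n

  -- Σ aₙ tⁿ/n!, for ι : ℚ → A the inclusion of scalars.
  egf : (ℚ → Carrier) → (ℕ → Carrier) → Series
  egf ι a n = ι (1/ n !) * a n

  -- The aₙ with f = Σ aₙ tⁿ/n!.
  egfCoefficient : Series → ℕ → Carrier
  egfCoefficient f n = (n !) · f n

------------------------------------------------------------------------
-- Laurent polynomials A[q,q⁻¹]: the list of pairs (k , a) stands for the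
-- sum of the a qᵏ. Exponents may repeat, so equality compares coefficients.

module LaurentPolynomials {a ℓ : Level} (A : RawRing a ℓ) where

  open RawRing A

  Laurent : Set a
  Laurent = List (ℤ × Carrier)

  coefficient : Laurent → ℤ → Carrier
  coefficient f k = foldr _+_ 0# (map proj₂ (filter (λ (i , _) → i ℤ.≟ k) f))

  laurent : RawRing a ℓ
  laurent = record
    { Carrier = Laurent
    ; _≈_     = λ f g → ∀ k → coefficient f k ≈ coefficient g k
    ; _+_     = _++_
    ; _*_     = cartesianProductWith (λ (i , x) (j , y) → i +ℤ j , x * y)
    ; -_      = map (λ (i , x) → i , - x)
    ; 0#      = []
    ; 1#      = (0ℤ , 1#) ∷ []
    }

  monomial : Carrier → ℤ → Laurent
  monomial x k = (k , x) ∷ []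

  constant : Carrier → Laurent
  constant x = monomial x 0ℤ

  q^_ : ℤ → Laurent
  q^ k = monomial 1# k

------------------------------------------------------------------------
-- φ k is the exponential coefficient φ[k]; ι is the inclusion of ℚ in R.

module EnrichedTrees {c ℓ : Level} (R : CommutativeRing c ℓ)
                     (ι : ℚ → CommutativeRing.Carrier R) (φ : ℕ → CommutativeRing.Carrier R) where

  open CommutativeRing R using (Carrier; _*_; 1#; rawRing)

  open LaurentPolynomials rawRing public
  module L where
    open RawRing laurent public
    open PowerSeries laurent public
  open PowerSeries rawRing using (Series; egf)

  treeWeight : IncreasingTree n → Carrier
  treeWeight {n} T = foldr _*_ 1# (map (λ v → φ (length (children T v))) (allFin n))

  p : ℕ → Laurent
  p n = foldr L._+_ L.0# (map (λ T → monomial (treeWeight T) (+ pathLength T)) (increasingTrees n))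

  P : L.Series
  P zero    = L.0#
  P (suc n) = L.egf (λ x → constant (ι x)) p (suc n)

  φ-series : Series
  φ-series = egf ι φ

  F : L.Series
  F = L.compose (λ k → constant (φ-series k)) P

  f : ℕ → Laurent
  f = L.egfCoefficient F

{-# OPTIONS --safe #-}
module Submission where

-- An increasing tree grows from its root by adding leaves in the order of
-- their labels. Let x_{k,h} stand for a vertex with k children at height h.
-- Adding a leaf in all possible ways is the derivation D of ℤ[x_{k,h}] with
-- D x_{k,h} = x_{k+1,h} x_{0,h+1}, so e^{tD} is multiplicative. Write X_{k,h}
-- for the value of e^{tD} x_{k,h} at x_{k,h} = φ[k] q^h. Then
--   X_{k,h}′ = X_{k+1,h} X_{0,h+1},   X_{0,0} = P′,   X_{0,1}(t) = q P′(qt),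
-- the last since raising a tree by one level multiplies its weight by q for
-- each vertex. Hence the X_{k,0} and the φ^{(k)}(P(qt)) satisfy the same
-- equations y_k′ = q P′(qt) y_{k+1}, y_k(0) = φ[k], whose solution is unique,
-- and k = 0 gives P′(t) = φ(P(qt)).

open import Defs
open import Algebra.Bundles using (CommutativeRing)
open import Algebra.Bundles.Raw using (RawRing)
import Algebra.Definitions.RawSemiring as RawSemiringDefs
open import Algebra.Morphism.Structures using (module RingMorphisms)
import Algebra.Properties.CommutativeMonoid.Mult as MonoidMult
import Algebra.Properties.CommutativeSemigroup as CommutativeSemigroupProperties
import Algebra.Properties.Group as GroupProperties
import Algebra.Properties.Ring as RingProperties
import Algebra.Properties.Semiring.Mult as SemiringMult
import Algebra.Properties.Semiring.Sum as SemiringSum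
open import Data.Bool.Base using (true; false; if_then_else_)
open import Data.Fin.Base using (Fin; zero; suc; toℕ; fromℕ; inject₁) renaming (_<_ to _<ᶠ_)
import Data.Fin.Properties as Fin
open import Data.Fin.Relation.Unary.Top using (View; view; ‵fromℕ; ‵inject₁)
open import Data.Integer.Base using (ℤ; +_; -1ℤ; 0ℤ) renaming (-_ to -ℤ_; _+_ to _+ℤ_; _*_ to _*ℤ_)
import Data.Integer.Properties as ℤ
open import Data.Integer.Tactic.RingSolver using (solve-∀)
open import Data.List.Base
  using (List; []; _∷_; _++_; _∷ʳ_; [_]; map; foldr; filter; length; tabulate; allFin; cartesianProductWith)
open import Data.List.Membership.Propositional using (_∈_)
open import Data.List.Membership.Propositional.Properties using (∈-map⁺; ∈-map⁻; ∈-allFin; ∈-cartesianProductWith⁺)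
open import Data.List.Membership.Propositional.Properties.WithK using (unique∧set⇒bag)
open import Data.List.Properties
  using (map-++; map-∘; map-id; map-tabulate; tabulate-cong; ++-assoc; ++-identityʳ; length-++;
         filter-++; filter-≐; filter-none; filter-accept; filter-reject; cartesianProductWith-distribʳ-++)
open import Data.List.Relation.Binary.BagAndSetEquality using (∼bag⇒↭)
open import Data.List.Relation.Binary.Permutation.Propositional using (_↭_; prep; swap)
open import Data.List.Relation.Binary.Permutation.Propositional.Properties using (∷↭∷ʳ)
import Data.List.Relation.Unary.All as All
open import Data.List.Relation.Unary.AllPairs using ([]; _∷_)
open import Data.List.Relation.Unary.Any using (here)
open import Data.List.Relation.Unary.Unique.Propositional using (Unique)
import Data.List.Relation.Unary.Unique.Propositional.Properties as Unique
open import Data.Maybe.Base using (Maybe; just; nothing; _>>=_) renaming (map to mapᵐ)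
import Data.Maybe.Properties as Maybe
open import Data.Nat.Base using (ℕ; zero; suc; _∸_; _!; _≤_; _<_; z≤n; s≤s; NonZero)
import Data.Nat.Base as ℕ
import Data.Nat.ListAction as ℕ
import Data.Nat.Properties as ℕ
open import Data.Product.Base using (_×_; _,_; ∃; proj₁; proj₂)
open import Data.Rational.Base using (ℚ; +-*-rawRing; 1ℚ; toℚᵘ) renaming (_/_ to _/ℚ_)
import Data.Rational.Properties as ℚ
open import Data.Rational.Unnormalised.Base using (mkℚᵘ; _≃_; *≡*)
import Data.Rational.Unnormalised.Properties as ℚᵘ
open import Data.Sum.Base using (_⊎_; inj₁; inj₂)
open import Data.Vec.Base as Vec using (Vec; lookup) renaming ([] to []ᵛ; _∷_ to _∷ᵛ_; _∷ʳ_ to _∷ʳᵛ_)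
open import Data.Vec.Functional using (updateAt)
open import Data.Vec.Functional.Properties using (updateAt-updates; updateAt-minimal)
import Data.Vec.Properties as Vec
open import Function.Base using (_∘_)
open import Function.Bundles using (mk⇔)
open import Relation.Binary.PropositionalEquality as ≡ using (_≡_)
import Relation.Binary.Reasoning.Setoid as SetoidReasoning
open import Relation.Nullary.Decidable using (Dec; yes; no; does)
open import Relation.Nullary.Negation using (¬_; contradiction)
open import Relation.Unary using (Pred; Decidable)

-- No polynomial ring in the infinitely many variables x_{k,h} is built. A list of pairs (outdegree,
-- height) plays the role of a monomial, `growths` applies the derivation to it, concatenation is
-- the product, and `W` evaluates after any number of steps. The shape of a tree can be forgotten
-- because its weight, and the ways in which it goes on growing, depend on these pairs alone. Series
-- are handled through their exponential coefficients: there the derivative is an index shift, so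
-- Leibniz' rule can define the product and no binomial coefficient occurs. The equation for X_{0,0}
-- does not close up, since each derivative raises k in one factor and h in the other. The
-- inductions therefore range over all k (and h) at once. They run on the index of the coefficient,
-- as coefficient i + 1 is determined by those up to i. The remaining gap is between the filtered
-- enumeration of parent maps and growth histories. It is bridged on parent maps, because trees also
-- carry proofs.

-- Exponential power series with Leibniz' rule.

module HurwitzSeries {a ℓ} (A : CommutativeRing a ℓ) where

  open CommutativeRing A hiding (zero)
  open SemiringMult semiring using (×-congʳ; ×-congˡ; ×-homo-+; ×-assocˡ; ×-comm-*; ×-assoc-*)
  open MonoidMult +-commutativeMonoid using (×-distrib-+)
  open SemiringSum semiring using (sum-cong-≋; sum-init-last; ∑-distrib-+)
  open RawSemiringDefs (RawRing.rawSemiring rawRing) using (sum; _^_) renaming (_×_ to _·_)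
  open CommutativeSemigroupProperties +-commutativeSemigroup using ()
    renaming (interchange to +-interchange)
  open SetoidReasoning setoid
  open PowerSeries rawRing using (series; compose; derivative; dilate; egf; egfCoefficient)

  private
    module S where
      open RawRing series public
      open RawSemiringDefs (RawRing.rawSemiring series) public

  ·-zeroʳ : ∀ m → m · 0# ≈ 0#
  ·-zeroʳ zero    = refl
  ·-zeroʳ (suc m) = trans (+-identityˡ _) (·-zeroʳ m)

  ·-sum : ∀ m {k} (x : Fin k → Carrier) → m · sum x ≈ sum (λ i → m · x i)
  ·-sum m {zero}  x = ·-zeroʳ m
  ·-sum m {suc k} x = trans (×-distrib-+ _ _ m) (+-congˡ (·-sum m (x ∘ suc)))

  -- The sequence x stands for the series Σ xₙ tⁿ/n!, with derivative D x and
  -- product _⋆_, defined by Leibniz' rule.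
  Seq : Set a
  Seq = ℕ → Carrier

  infix 4 _≐_
  _≐_ : Seq → Seq → Set ℓ
  x ≐ y = ∀ n → x n ≈ y n

  D : Seq → Seq
  D x n = x (suc n)

  infixl 7 _⋆_
  _⋆_ : Seq → Seq → Seq
  (x ⋆ y) zero    = x 0 * y 0
  (x ⋆ y) (suc n) = (D x ⋆ y) n + (x ⋆ D y) n

  ε : Seq
  ε zero    = 1#
  ε (suc _) = 0#

  infixr 8 _^⋆_
  _^⋆_ : Seq → ℕ → Seq
  x ^⋆ zero  = ε
  x ^⋆ suc k = x ⋆ x ^⋆ k

  -- Coefficient `n` of a product sees both factors only up to `n`. The bounded form serves the
  -- inductions on coefficients, where equality is known only that far.
  ⋆-cong-≤ : ∀ n {x x′ y y′} → (∀ {i} → i ≤ n → x i ≈ x′ i) → (∀ {i} → i ≤ n → y i ≈ y′ i) →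
             (x ⋆ y) n ≈ (x′ ⋆ y′) n
  ⋆-cong-≤ zero    p q = *-cong (p z≤n) (q z≤n)
  ⋆-cong-≤ (suc n) p q = +-cong
    (⋆-cong-≤ n (λ i≤n → p (s≤s i≤n)) (λ i≤n → q (ℕ.m≤n⇒m≤1+n i≤n)))
    (⋆-cong-≤ n (λ i≤n → p (ℕ.m≤n⇒m≤1+n i≤n)) (λ i≤n → q (s≤s i≤n)))

  ⋆-cong : ∀ {x x′ y y′} → x ≐ x′ → y ≐ y′ → x ⋆ y ≐ x′ ⋆ y′
  ⋆-cong p q n = ⋆-cong-≤ n (λ {i} _ → p i) (λ {i} _ → q i)

  ⋆-congˡ : ∀ {x y y′} → y ≐ y′ → x ⋆ y ≐ x ⋆ y′
  ⋆-congˡ = ⋆-cong (λ _ → refl)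

  ⋆-congʳ : ∀ {x x′ y} → x ≐ x′ → x ⋆ y ≐ x′ ⋆ y
  ⋆-congʳ p = ⋆-cong p (λ _ → refl)

  ⋆-comm : ∀ x y → x ⋆ y ≐ y ⋆ x
  ⋆-comm x y zero    = *-comm _ _
  ⋆-comm x y (suc n) = trans (+-cong (⋆-comm (D x) y n) (⋆-comm x (D y) n)) (+-comm _ _)

  ⋆-zeroˡ : ∀ y → (λ _ → 0#) ⋆ y ≐ (λ _ → 0#)
  ⋆-zeroˡ y zero    = zeroˡ _
  ⋆-zeroˡ y (suc n) = trans (+-cong (⋆-zeroˡ y n) (⋆-zeroˡ (D y) n)) (+-identityˡ _)

  ⋆-identityˡ : ∀ x → ε ⋆ x ≐ x
  ⋆-identityˡ x zero    = *-identityˡ _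
  ⋆-identityˡ x (suc n) = trans (+-cong (⋆-zeroˡ x n) (⋆-identityˡ (D x) n)) (+-identityˡ _)

  ⋆-distribʳ : ∀ z x y → (λ i → x i + y i) ⋆ z ≐ (λ i → (x ⋆ z) i + (y ⋆ z) i)
  ⋆-distribʳ z x y zero    = distribʳ _ _ _
  ⋆-distribʳ z x y (suc n) =
    trans (+-cong (⋆-distribʳ z (D x) (D y) n) (⋆-distribʳ (D z) x y n)) (+-interchange _ _ _ _)

  ⋆-distribˡ : ∀ x y z → x ⋆ (λ i → y i + z i) ≐ (λ i → (x ⋆ y) i + (x ⋆ z) i)
  ⋆-distribˡ x y z n = trans (⋆-comm x _ n)
    (trans (⋆-distribʳ x y z n) (+-cong (⋆-comm y x n) (⋆-comm z x n)))

  ⋆-scaleˡ : ∀ c x y → (λ i → c * x i) ⋆ y ≐ (λ i → c * (x ⋆ y) i)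
  ⋆-scaleˡ c x y zero    = *-assoc _ _ _
  ⋆-scaleˡ c x y (suc n) = trans (+-cong (⋆-scaleˡ c (D x) y n) (⋆-scaleˡ c x (D y) n)) (sym (distribˡ _ _ _))

  ⋆-scaleʳ : ∀ c x y → x ⋆ (λ i → c * y i) ≐ (λ i → c * (x ⋆ y) i)
  ⋆-scaleʳ c x y n = trans (⋆-comm x _ n) (trans (⋆-scaleˡ c y x n) (*-congˡ (⋆-comm y x n)))

  ⋆-·ʳ : ∀ m x y → x ⋆ (λ i → m · y i) ≐ (λ i → m · (x ⋆ y) i)
  ⋆-·ʳ zero    x y n = trans (⋆-comm x _ n) (⋆-zeroˡ x n)
  ⋆-·ʳ (suc m) x y n = trans (⋆-distribˡ x y _ n) (+-congˡ (⋆-·ʳ m x y n))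

  ⋆-assoc : ∀ x y z → (x ⋆ y) ⋆ z ≐ x ⋆ (y ⋆ z)
  ⋆-assoc x y z zero    = *-assoc _ _ _
  ⋆-assoc x y z (suc n) = begin
    (D (x ⋆ y) ⋆ z) n + ((x ⋆ y) ⋆ D z) n
      ≈⟨ +-congʳ (⋆-distribʳ z (D x ⋆ y) (x ⋆ D y) n) ⟩
    ((D x ⋆ y) ⋆ z) n + ((x ⋆ D y) ⋆ z) n + ((x ⋆ y) ⋆ D z) n
      ≈⟨ +-cong (+-cong (⋆-assoc (D x) y z n) (⋆-assoc x (D y) z n)) (⋆-assoc x y (D z) n) ⟩
    (D x ⋆ (y ⋆ z)) n + (x ⋆ (D y ⋆ z)) n + (x ⋆ (y ⋆ D z)) n
      ≈⟨ +-assoc _ _ _ ⟩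
    (D x ⋆ (y ⋆ z)) n + ((x ⋆ (D y ⋆ z)) n + (x ⋆ (y ⋆ D z)) n)
      ≈⟨ +-congˡ (⋆-distribˡ x (D y ⋆ z) (y ⋆ D z) n) ⟨
    (D x ⋆ (y ⋆ z)) n + (x ⋆ D (y ⋆ z)) n ∎

  ⋆-distribʳ-sum : ∀ {m} z (x : Fin m → Seq) → (λ i → sum (λ k → x k i)) ⋆ z ≐ (λ i → sum (λ k → (x k ⋆ z) i))
  ⋆-distribʳ-sum {zero}  z x n = ⋆-zeroˡ z n
  ⋆-distribʳ-sum {suc m} z x n = trans (⋆-distribʳ z (x zero) _ n) (+-congˡ (⋆-distribʳ-sum z (x ∘ suc) n))

  -- By the chain rule, `D (δ x)` is `c` times `δ (D x)`. In each half of Leibniz' rule this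
  -- supplies the one factor by which `c ^ suc n` exceeds `c ^ n`.
  ⋆-dilate : ∀ c x y → dilate c x ⋆ dilate c y ≐ dilate c (x ⋆ y)
  ⋆-dilate c x y zero    = begin
    (1# * x 0) * (1# * y 0) ≈⟨ *-cong (*-identityˡ _) (*-identityˡ _) ⟩
    x 0 * y 0               ≈⟨ *-identityˡ _ ⟨
    1# * (x 0 * y 0)        ∎
  ⋆-dilate c x y (suc n) = begin
    (D (δ x) ⋆ δ y) n + (δ x ⋆ D (δ y)) n
      ≈⟨ +-cong (⋆-congʳ (λ _ → *-assoc _ _ _) n) (⋆-congˡ (λ _ → *-assoc _ _ _) n) ⟩
    ((λ i → c * δ (D x) i) ⋆ δ y) n + (δ x ⋆ (λ i → c * δ (D y) i)) n
      ≈⟨ +-cong (⋆-scaleˡ c (δ (D x)) (δ y) n) (⋆-scaleʳ c (δ x) (δ (D y)) n) ⟩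
    c * (δ (D x) ⋆ δ y) n + c * (δ x ⋆ δ (D y)) n
      ≈⟨ +-cong (*-congˡ (⋆-dilate c (D x) y n)) (*-congˡ (⋆-dilate c x (D y) n)) ⟩
    c * (c ^ n * (D x ⋆ y) n) + c * (c ^ n * (x ⋆ D y) n)
      ≈⟨ +-cong (*-assoc _ _ _) (*-assoc _ _ _) ⟨
    c ^ suc n * (D x ⋆ y) n + c ^ suc n * (x ⋆ D y) n
      ≈⟨ distribˡ _ _ _ ⟨
    c ^ suc n * (x ⋆ y) (suc n) ∎
    where
    δ : Seq → Seq
    δ = dilate c

  D-^⋆ : ∀ x k → D (x ^⋆ suc k) ≐ (λ n → suc k · (x ^⋆ k ⋆ D x) n)
  D-^⋆ x zero    n = begin
    (D x ⋆ ε) n + (x ⋆ D ε) n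
      ≈⟨ +-cong (⋆-comm (D x) ε n) (trans (⋆-comm x (D ε) n) (⋆-zeroˡ x n)) ⟩
    (ε ⋆ D x) n + 0# ∎
  D-^⋆ x (suc k) n = +-cong (⋆-comm (D x) (x ^⋆ suc k) n) (begin
    (x ⋆ D (x ^⋆ suc k)) n                      ≈⟨ ⋆-congˡ (D-^⋆ x k) n ⟩
    (x ⋆ (λ i → suc k · (x ^⋆ k ⋆ D x) i)) n   ≈⟨ ⋆-·ʳ (suc k) x (x ^⋆ k ⋆ D x) n ⟩
    suc k · (x ⋆ (x ^⋆ k ⋆ D x)) n             ≈⟨ ×-congʳ (suc k) (⋆-assoc x (x ^⋆ k) (D x) n) ⟨
    suc k · (x ^⋆ suc k ⋆ D x) n               ∎)

  -- The power rule passes from coefficient `suc i` of the power `suc k` to coefficient `i` of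
  -- `x ^⋆ k ⋆ D x`, which involves `x ^⋆ k` only at indices below `k`.
  ^⋆-vanishes : ∀ x → x 0 ≈ 0# → ∀ k {i} → i < k → (x ^⋆ k) i ≈ 0#
  ^⋆-vanishes x x₀ (suc k) {zero}  _         = trans (*-congʳ x₀) (zeroˡ _)
  ^⋆-vanishes x x₀ (suc k) {suc i} (s≤s i<k) = begin
    (x ^⋆ suc k) (suc i)          ≈⟨ D-^⋆ x k i ⟩
    suc k · (x ^⋆ k ⋆ D x) i      ≈⟨ ×-congʳ (suc k)
                                       (⋆-cong-≤ i (λ j≤i → ^⋆-vanishes x x₀ k (ℕ.≤-<-trans j≤i i<k)) (λ _ → refl)) ⟩
    suc k · ((λ _ → 0#) ⋆ D x) i  ≈⟨ ×-congʳ (suc k) (⋆-zeroˡ (D x) i) ⟩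
    suc k · 0#                    ≈⟨ ·-zeroʳ (suc k) ⟩
    0#                            ∎

  -- Leibniz' rule for the Euler operator f ↦ t f′, which needs no index shift.
  euler-* : ∀ f g n → n · (f S.* g) n ≈ ((λ i → i · f i) S.* g) n + (f S.* (λ i → i · g i)) n
  euler-* f g n = begin
    n · sum {suc n} (λ i → f (toℕ i) * g (n ∸ toℕ i))
      ≈⟨ ·-sum n {suc n} (λ i → f (toℕ i) * g (n ∸ toℕ i)) ⟩
    sum {suc n} (λ i → n · (f (toℕ i) * g (n ∸ toℕ i)))
      ≈⟨ sum-cong-≋ term ⟩
    sum {suc n} (λ i → (toℕ i · f (toℕ i)) * g (n ∸ toℕ i) + f (toℕ i) * ((n ∸ toℕ i) · g (n ∸ toℕ i)))
      ≈⟨ ∑-distrib-+ {suc n} (λ i → (toℕ i · f (toℕ i)) * g (n ∸ toℕ i))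
                             (λ i → f (toℕ i) * ((n ∸ toℕ i) · g (n ∸ toℕ i))) ⟩
    ((λ i → i · f i) S.* g) n + (f S.* (λ i → i · g i)) n ∎
    where
    term : ∀ (i : Fin (suc n)) → n · (f (toℕ i) * g (n ∸ toℕ i)) ≈
           (toℕ i · f (toℕ i)) * g (n ∸ toℕ i) + f (toℕ i) * ((n ∸ toℕ i) · g (n ∸ toℕ i))
    term i = begin
      n · z                       ≈⟨ ×-congˡ (ℕ.m+[n∸m]≡n (Fin.toℕ≤pred[n] i)) ⟨
      (toℕ i ℕ.+ (n ∸ toℕ i)) · z ≈⟨ ×-homo-+ z (toℕ i) (n ∸ toℕ i) ⟩
      toℕ i · z + (n ∸ toℕ i) · z ≈⟨ +-cong (×-assoc-* (toℕ i) _ _) (×-comm-* (n ∸ toℕ i) _ _) ⟨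
      (toℕ i · f (toℕ i)) * g (n ∸ toℕ i) + f (toℕ i) * ((n ∸ toℕ i) · g (n ∸ toℕ i)) ∎
      where z = f (toℕ i) * g (n ∸ toℕ i)

  -- Isolates the boundary term with `g 0`. Applied to `i · g i`, that term is zero and the rest is
  -- the convolution with the derivative; the mirror image for the left factor holds by unfolding
  -- `sum`.
  *-unfoldʳ : ∀ f g n → (f S.* g) (suc n) ≈ (f S.* (g ∘ suc)) n + f (suc n) * g 0
  *-unfoldʳ f g n = trans (sum-init-last {suc n} (λ i → f (toℕ i) * g (suc n ∸ toℕ i)))
    (+-cong (sum-cong-≋ {suc n} λ i → reflexive (≡.cong₂ (λ j k → f j * g k) (Fin.toℕ-inject₁ i) (
              ≡.trans (≡.cong (suc n ∸_) (Fin.toℕ-inject₁ i)) (ℕ.+-∸-assoc 1 (Fin.toℕ≤pred[n] i)))))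
            (reflexive (≡.cong₂ (λ j k → f j * g k) (Fin.toℕ-fromℕ (suc n))
              (≡.trans (≡.cong (suc n ∸_) (Fin.toℕ-fromℕ (suc n))) (ℕ.n∸n≡0 n)))))

  derivative-* : ∀ f g n → derivative (f S.* g) n ≈ (derivative f S.* g) n + (f S.* derivative g) n
  derivative-* f g n = begin
    suc n · (f S.* g) (suc n)
      ≈⟨ euler-* f g (suc n) ⟩
    0# * g (suc n) + (derivative f S.* g) n + (f S.* (λ i → i · g i)) (suc n)
      ≈⟨ +-cong (trans (+-congʳ (zeroˡ _)) (+-identityˡ _)) (*-unfoldʳ f (λ i → i · g i) n) ⟩
    (derivative f S.* g) n + ((f S.* derivative g) n + f (suc n) * 0#)
      ≈⟨ +-congˡ (trans (+-congˡ (zeroʳ _)) (+-identityʳ _)) ⟩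
    (derivative f S.* g) n + (f S.* derivative g) n ∎

  egfCoefficient-derivative : ∀ f → egfCoefficient (derivative f) ≐ D (egfCoefficient f)
  egfCoefficient-derivative f n = trans (×-assocˡ _ (n !) (suc n)) (×-congˡ (ℕ.*-comm (n !) (suc n)))

  -- Both products obey Leibniz' rule and agree at 0, and `egfCoefficient` turns the derivative into
  -- `D`; this settles all coefficients without an identity for factorials.
  egfCoefficient-* : ∀ f g → egfCoefficient (f S.* g) ≐ egfCoefficient f ⋆ egfCoefficient g
  egfCoefficient-* f g zero = begin
    f 0 * g 0 + 0# + 0#         ≈⟨ trans (+-identityʳ _) (+-identityʳ _) ⟩
    f 0 * g 0                   ≈⟨ *-cong (+-identityʳ _) (+-identityʳ _) ⟨
    (f 0 + 0#) * (g 0 + 0#)     ∎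
  egfCoefficient-* f g (suc n) = begin
    egfCoefficient (f S.* g) (suc n)
      ≈⟨ egfCoefficient-derivative (f S.* g) n ⟨
    (n !) · derivative (f S.* g) n
      ≈⟨ ×-congʳ (n !) (derivative-* f g n) ⟩
    (n !) · ((derivative f S.* g) n + (f S.* derivative g) n)
      ≈⟨ ×-distrib-+ _ _ (n !) ⟩
    egfCoefficient (derivative f S.* g) n + egfCoefficient (f S.* derivative g) n
      ≈⟨ +-cong (egfCoefficient-* (derivative f) g n) (egfCoefficient-* f (derivative g) n) ⟩
    (egfCoefficient (derivative f) ⋆ egfCoefficient g) n + (egfCoefficient f ⋆ egfCoefficient (derivative g)) n
      ≈⟨ +-cong (⋆-congʳ (egfCoefficient-derivative f) n) (⋆-congˡ (egfCoefficient-derivative g) n) ⟩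
    (egfCoefficient f ⋆ egfCoefficient g) (suc n) ∎

  egfCoefficient-^ : ∀ f k → egfCoefficient (f S.^ k) ≐ egfCoefficient f ^⋆ k
  egfCoefficient-^ f zero    zero    = +-identityʳ _
  egfCoefficient-^ f zero    (suc n) = ·-zeroʳ (suc n !)
  egfCoefficient-^ f (suc k) n =
    trans (egfCoefficient-* f (f S.^ k) n) (⋆-congˡ (egfCoefficient-^ f k) n)

  -- Composition of exponential series and the chain rule.

  module Composition (ι : ℚ → Carrier) (ι-inverse : ∀ n → (n !) · ι (1/ n !) ≈ 1#) where

    -- Cancellation: `n !` is a unit by `ι-inverse`, and both sides become `1#` when multiplied by
    -- it.
    1/!-suc : ∀ n → suc n · ι (1/ suc n !) ≈ ι (1/ n !)
    1/!-suc n = begin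
      y                                     ≈⟨ *-identityˡ y ⟨
      1# * y                                ≈⟨ *-congʳ (ι-inverse n) ⟨
      ((n !) · ι (1/ n !)) * y              ≈⟨ ×-assoc-* (n !) _ _ ⟩
      (n !) · (ι (1/ n !) * y)              ≈⟨ ×-comm-* (n !) _ _ ⟨
      ι (1/ n !) * ((n !) · y)              ≈⟨ *-congˡ (egfCoefficient-derivative (λ k → ι (1/ k !)) n) ⟩
      ι (1/ n !) * ((suc n !) · ι (1/ suc n !)) ≈⟨ *-congˡ (ι-inverse (suc n)) ⟩
      ι (1/ n !) * 1#                       ≈⟨ *-identityʳ _ ⟩
      ι (1/ n !)                            ∎
      where y = suc n · ι (1/ suc n !)

    egfCoefficient-egf : ∀ x → egfCoefficient (egf ι x) ≐ x
    egfCoefficient-egf x n = begin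
      (n !) · (ι (1/ n !) * x n)   ≈⟨ ×-assoc-* (n !) _ _ ⟨
      ((n !) · ι (1/ n !)) * x n   ≈⟨ *-congʳ (ι-inverse n) ⟩
      1# * x n                     ≈⟨ *-identityˡ _ ⟩
      x n                          ∎

    egf-egfCoefficient : ∀ f → egf ι (egfCoefficient f) ≐ f
    egf-egfCoefficient f n = trans (×-comm-* (n !) _ _) (egfCoefficient-egf f n)

    derivative-egf : ∀ x → derivative (egf ι x) ≐ egf ι (D x)
    derivative-egf x n = trans (sym (×-assoc-* (suc n) _ _)) (*-congʳ (1/!-suc n))

    -- The exponential coefficients of φ(x(t)). The cut at k ≤ n loses nothing when `x 0` is zero,
    -- but it makes the range of summation depend on the coefficient.
    composite : Seq → Seq → Seq
    composite φ x n = sum {suc n} (λ k → egf ι φ (toℕ k) * (x ^⋆ toℕ k) n)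

    egfCoefficient-compose : ∀ φ g → egfCoefficient (compose (egf ι φ) g) ≐ composite φ (egfCoefficient g)
    egfCoefficient-compose φ g n = trans
      (·-sum (n !) {suc n} (λ k → egf ι φ (toℕ k) * (g S.^ toℕ k) n))
      (sum-cong-≋ {suc n} λ k → trans (sym (×-comm-* (n !) (egf ι φ (toℕ k)) _)) (*-congˡ (egfCoefficient-^ g (toℕ k) n)))

    composite-zero : ∀ φ x → composite φ x 0 ≈ φ 0
    composite-zero φ x = begin
      ι (1/ 0 !) * φ 0 * 1# + 0#  ≈⟨ trans (+-identityʳ _) (*-identityʳ _) ⟩
      ι (1/ 0 !) * φ 0            ≈⟨ +-identityʳ _ ⟨
      egfCoefficient (egf ι φ) 0  ≈⟨ egfCoefficient-egf φ 0 ⟩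
      φ 0                         ∎

    sum-truncate : ∀ {m n} → m ≤ n → (z : ℕ → Carrier) → (∀ k → m ≤ k → z k ≈ 0#) →
                   sum {n} (z ∘ toℕ) ≈ sum {m} (z ∘ toℕ)
    sum-truncate {n = zero}  z≤n       z p = refl
    sum-truncate {n = suc n} z≤n       z p =
      trans (+-cong (p 0 z≤n) (sum-truncate {n = n} z≤n (z ∘ suc) (λ k _ → p (suc k) z≤n))) (+-identityˡ _)
    sum-truncate             (s≤s m≤n) z p = +-congˡ (sum-truncate m≤n (z ∘ suc) (λ k m≤k → p (suc k) (s≤s m≤k)))

    -- The chain rule holds term by term: the factor `suc k` of the power rule turns the denominator
    -- (k+1)! into k!. What remains is to reconcile the ranges of summation.
    D-composite : ∀ φ x → x 0 ≈ 0# → D (composite φ x) ≐ composite (D φ) x ⋆ D x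
    D-composite φ x x₀ n = begin
      -- The term `k = 0` contributes `ε (suc n)`, which is `0#`.
      egf ι φ 0 * 0# + sum {suc n} (λ k → egf ι φ (suc (toℕ k)) * D (x ^⋆ suc (toℕ k)) n)
        ≈⟨ trans (+-congʳ (zeroʳ _)) (+-identityˡ _) ⟩
      sum {suc n} (λ k → egf ι φ (suc (toℕ k)) * D (x ^⋆ suc (toℕ k)) n)
        ≈⟨ sum-cong-≋ {suc n} (λ k → term (toℕ k)) ⟩
      sum {suc n} (λ k → ((λ i → egf ι (D φ) (toℕ k) * (x ^⋆ toℕ k) i) ⋆ D x) n)
        ≈⟨ ⋆-distribʳ-sum {suc n} (D x) (λ k i → egf ι (D φ) (toℕ k) * (x ^⋆ toℕ k) i) n ⟨
      ((λ i → sum {suc n} (λ k → egf ι (D φ) (toℕ k) * (x ^⋆ toℕ k) i)) ⋆ D x) n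
        -- At coefficient `i` the inner sum still runs up to `n`, while `composite` stops at `i`;
        -- the surplus powers vanish there.
        ≈⟨ ⋆-cong-≤ n (λ {i} i≤n → sum-truncate (s≤s i≤n) (λ k → egf ι (D φ) k * (x ^⋆ k) i)
                        (λ k i<k → trans (*-congˡ (^⋆-vanishes x x₀ k i<k)) (zeroʳ _)))
                      (λ _ → refl) ⟩
      (composite (D φ) x ⋆ D x) n ∎
      where
      term : ∀ k → egf ι φ (suc k) * D (x ^⋆ suc k) n ≈ ((λ i → egf ι (D φ) k * (x ^⋆ k) i) ⋆ D x) n
      term k = begin
        egf ι φ (suc k) * D (x ^⋆ suc k) n               ≈⟨ *-congˡ (D-^⋆ x k n) ⟩
        egf ι φ (suc k) * (suc k · (x ^⋆ k ⋆ D x) n)     ≈⟨ ×-comm-* (suc k) _ _ ⟩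
        suc k · (egf ι φ (suc k) * (x ^⋆ k ⋆ D x) n)     ≈⟨ ×-assoc-* (suc k) _ _ ⟨
        (suc k · egf ι φ (suc k)) * (x ^⋆ k ⋆ D x) n     ≈⟨ *-congʳ (derivative-egf φ k) ⟩
        egf ι (D φ) k * (x ^⋆ k ⋆ D x) n                 ≈⟨ ⋆-scaleˡ _ (x ^⋆ k) (D x) n ⟨
        ((λ i → egf ι (D φ) k * (x ^⋆ k) i) ⋆ D x) n     ∎

-- Forests as lists of vertices, and the addition of a leaf.

-- The outdegree and the height of a vertex.
Vertex : Set
Vertex = ℕ × ℕ

gainChild : Vertex → Vertex
gainChild (k , h) = suc k , h

newChild : Vertex → Vertex
newChild (k , h) = 0 , suc h

-- The new leaf is placed next to its parent, rather than at the end, so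
-- that growths distributes over _++_.
growths : List Vertex → List (List Vertex)
growths []      = []
growths (v ∷ L) = (gainChild v ∷ newChild v ∷ L) ∷ map (v ∷_) (growths L)

-- The parent lies in one of the two blocks and the new leaf stays in the same block: Leibniz' rule
-- in combinatorial form.
growths-++ : ∀ L M → growths (L ++ M) ≡ map (_++ M) (growths L) ++ map (L ++_) (growths M)
growths-++ []      M = ≡.sym (map-id (growths M))
growths-++ (v ∷ L) M = ≡.cong ((gainChild v ∷ newChild v ∷ L ++ M) ∷_) (begin
  map (v ∷_) (growths (L ++ M))
    ≡⟨ ≡.cong (map (v ∷_)) (growths-++ L M) ⟩
  map (v ∷_) (map (_++ M) (growths L) ++ map (L ++_) (growths M))
    ≡⟨ map-++ (v ∷_) (map (_++ M) (growths L)) _ ⟩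
  map (v ∷_) (map (_++ M) (growths L)) ++ map (v ∷_) (map (L ++_) (growths M))
    ≡⟨ ≡.cong₂ _++_ (≡.trans (≡.sym (map-∘ (growths L))) (map-∘ (growths L))) (≡.sym (map-∘ (growths M))) ⟩
  map (_++ M) (map (v ∷_) (growths L)) ++ map ((v ∷ L) ++_) (growths M) ∎)
  where open ≡.≡-Reasoning

-- Sums over lists.

module ListSum {a ℓ} (A : CommutativeRing a ℓ) where

  open CommutativeRing A
  open HurwitzSeries A

  ∑ : ∀ {b} {B : Set b} → (B → Carrier) → List B → Carrier
  ∑ g xs = foldr _+_ 0# (map g xs)

  module _ {b} {B : Set b} where

    ∑-cong : ∀ {g g′ : B → Carrier} → (∀ x → g x ≈ g′ x) → ∀ xs → ∑ g xs ≈ ∑ g′ xs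
    ∑-cong p []       = refl
    ∑-cong p (x ∷ xs) = +-cong (p x) (∑-cong p xs)

    ∑-++ : ∀ (g : B → Carrier) xs ys → ∑ g (xs ++ ys) ≈ ∑ g xs + ∑ g ys
    ∑-++ g []       ys = sym (+-identityˡ _)
    ∑-++ g (x ∷ xs) ys = trans (+-congˡ (∑-++ g xs ys)) (sym (+-assoc _ _ _))

    ∑-map : ∀ {c} {C : Set c} (g : B → Carrier) (f : C → B) xs → ∑ g (map f xs) ≈ ∑ (g ∘ f) xs
    ∑-map g f xs = reflexive (≡.cong (foldr _+_ 0#) (≡.sym (map-∘ xs)))

    ⋆-distribʳ-∑ : ∀ z (g : B → Seq) xs → (λ i → ∑ (λ x → g x i) xs) ⋆ z ≐ (λ i → ∑ (λ x → (g x ⋆ z) i) xs)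
    ⋆-distribʳ-∑ z g []       n = ⋆-zeroˡ z n
    ⋆-distribʳ-∑ z g (x ∷ xs) n = trans (⋆-distribʳ z (g x) _ n) (+-congˡ (⋆-distribʳ-∑ z g xs n))

    ⋆-distribˡ-∑ : ∀ z (g : B → Seq) xs → z ⋆ (λ i → ∑ (λ x → g x i) xs) ≐ (λ i → ∑ (λ x → (z ⋆ g x) i) xs)
    ⋆-distribˡ-∑ z g xs n = trans (⋆-comm z _ n) (trans (⋆-distribʳ-∑ z g xs n) (∑-cong (λ x → ⋆-comm (g x) z n) xs))

    ∑-↭ : ∀ (g : B → Carrier) {xs ys} → xs ↭ ys → ∑ g xs ≈ ∑ g ys
    ∑-↭ g _↭_.refl         = refl
    ∑-↭ g (prep x p)    = +-congˡ (∑-↭ g p)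
    ∑-↭ g (swap x y p)  = trans (x∙yz≈y∙xz _ _ _) (+-congˡ (+-congˡ (∑-↭ g p)))
      where open CommutativeSemigroupProperties +-commutativeSemigroup using (x∙yz≈y∙xz)
    ∑-↭ g (_↭_.trans p q)  = trans (∑-↭ g p) (∑-↭ g q)

-- The weight series of growing forests and its differential equations.

module Growth {a ℓ} (A : CommutativeRing a ℓ) (φ : ℕ → CommutativeRing.Carrier A) (q : CommutativeRing.Carrier A) where

  open CommutativeRing A hiding (zero)
  open HurwitzSeries A
  open PowerSeries rawRing using (dilate)
  open ListSum A
  open RawSemiringDefs (RawRing.rawSemiring rawRing) using (_^_) renaming (_×_ to _·_)
  open CommutativeSemigroupProperties *-commutativeSemigroup using (x∙yz≈y∙xz)
  open SetoidReasoning setoid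

  weight : Vertex → Carrier
  weight (k , h) = φ k * q ^ h

  weights : List Vertex → Carrier
  weights L = foldr _*_ 1# (map weight L)

  weights-++ : ∀ L M → weights (L ++ M) ≈ weights L * weights M
  weights-++ []      M = sym (*-identityˡ _)
  weights-++ (v ∷ L) M = trans (*-congˡ (weights-++ L M)) (sym (*-assoc _ _ _))

  -- W L n is the total weight of the outcomes of adding n new leaves, one
  -- after the other, to a forest with the vertices L.
  W : List Vertex → Seq
  W L zero    = weights L
  W L (suc n) = ∑ (λ M → W M n) (growths L)

  -- Adding a leaf acts as a derivation, whence the product rule.
  W-++ : ∀ L M → W (L ++ M) ≐ W L ⋆ W M
  W-++ L M zero    = weights-++ L M
  W-++ L M (suc n) = begin
    ∑ Wₙ (growths (L ++ M))
      ≡⟨ ≡.cong (∑ Wₙ) (growths-++ L M) ⟩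
    ∑ Wₙ (map (_++ M) (growths L) ++ map (L ++_) (growths M))
      ≈⟨ ∑-++ Wₙ (map (_++ M) (growths L)) _ ⟩
    ∑ Wₙ (map (_++ M) (growths L)) + ∑ Wₙ (map (L ++_) (growths M))
      ≈⟨ +-cong (∑-map Wₙ (_++ M) (growths L)) (∑-map Wₙ (L ++_) (growths M)) ⟩
    ∑ (λ N → W (N ++ M) n) (growths L) + ∑ (λ N → W (L ++ N) n) (growths M)
      ≈⟨ +-cong (∑-cong (λ N → W-++ N M n) (growths L)) (∑-cong (λ N → W-++ L N n) (growths M)) ⟩
    ∑ (λ N → (W N ⋆ W M) n) (growths L) + ∑ (λ N → (W L ⋆ W N) n) (growths M)
      ≈⟨ +-cong (⋆-distribʳ-∑ (W M) W (growths L) n) (⋆-distribˡ-∑ (W L) W (growths M) n) ⟨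
    (W L ⋆ W M) (suc n) ∎
    where
    Wₙ : List Vertex → Carrier
    Wₙ N = W N n

  -- By `W-++` a permutation only reorders factors of a commutative product, so the positions at
  -- which leaves are inserted never have to be tracked.
  W-↭ : ∀ {L M} → L ↭ M → W L ≐ W M
  W-↭ _↭_.refl                   n = refl
  W-↭ (prep {xs} {ys} v p)    n = begin
    W (v ∷ xs) n           ≈⟨ W-++ [ v ] xs n ⟩
    (W [ v ] ⋆ W xs) n     ≈⟨ ⋆-congˡ (W-↭ p) n ⟩
    (W [ v ] ⋆ W ys) n     ≈⟨ W-++ [ v ] ys n ⟨
    W (v ∷ ys) n           ∎
  W-↭ (swap {xs} {ys} v w p)  n = begin
    W (v ∷ w ∷ xs) n                 ≈⟨ W-++ (v ∷ w ∷ []) xs n ⟩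
    (W (v ∷ w ∷ []) ⋆ W xs) n        ≈⟨ ⋆-cong pair (W-↭ p) n ⟩
    (W (w ∷ v ∷ []) ⋆ W ys) n        ≈⟨ W-++ (w ∷ v ∷ []) ys n ⟨
    W (w ∷ v ∷ ys) n                 ∎
    where
    pair : W (v ∷ w ∷ []) ≐ W (w ∷ v ∷ [])
    pair i = trans (W-++ [ v ] [ w ] i) (trans (⋆-comm (W [ v ]) (W [ w ]) i) (sym (W-++ [ w ] [ v ] i)))
  W-↭ (_↭_.trans p r)            n = trans (W-↭ p n) (W-↭ r n)

  -- Reconciles the two places for a new leaf: next to its parent in `growths`, last in a labelled
  -- tree. An arbitrary order-insensitive `g` is allowed so that the induction can absorb the head
  -- vertex into it.
  ∑-growths-tabulate : ∀ (g : List Vertex → Carrier) → (∀ {L M} → L ↭ M → g L ≈ g M) →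
    ∀ {m} (s : Fin m → Vertex) →
    ∑ g (growths (tabulate s)) ≈ foldr _+_ 0# (tabulate (λ v → g (tabulate (updateAt s v gainChild) ∷ʳ newChild (s v))))
  ∑-growths-tabulate g g-↭ {zero}  s = refl
  ∑-growths-tabulate g g-↭ {suc m} s = +-cong
    (g-↭ (prep _ (∷↭∷ʳ (newChild (s zero)) (tabulate (s ∘ suc)))))
    (trans (∑-map g (s zero ∷_) (growths (tabulate (s ∘ suc))))
           (∑-growths-tabulate (λ L → g (s zero ∷ L)) (λ p → g-↭ (prep _ p)) (s ∘ suc)))

  X : ℕ → ℕ → Seq
  X k h = W [ k , h ]

  X-zero : ∀ k h → X k h 0 ≈ φ k * q ^ h
  X-zero k h = *-identityʳ _

  D-X : ∀ k h → D (X k h) ≐ X (suc k) h ⋆ X 0 (suc h)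
  D-X k h n = trans (+-identityʳ _) (W-++ [ suc k , h ] [ 0 , suc h ] n)

  -- After `i` additions there are `i + 1` vertices, each raised by one level: hence `q * q ^ i`.
  -- The separate bound `n` makes this a strong induction, as the product rule calls for all indices
  -- up to `i`, at other `k` and `h`.
  X-raise : ∀ n k h {i} → i ≤ n → X k (suc h) i ≈ q * (q ^ i * X k h i)
  X-raise n k h {zero} _ = begin
    X k (suc h) 0           ≈⟨ X-zero k (suc h) ⟩
    φ k * (q * q ^ h)       ≈⟨ x∙yz≈y∙xz _ _ _ ⟩
    q * (φ k * q ^ h)       ≈⟨ *-congˡ (X-zero k h) ⟨
    q * X k h 0             ≈⟨ *-congˡ (*-identityˡ _) ⟨
    q * (1# * X k h 0)      ∎
  X-raise (suc n) k h {suc i} (s≤s i≤n) = begin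
    X k (suc h) (suc i)
      ≈⟨ D-X k (suc h) i ⟩
    (X (suc k) (suc h) ⋆ X 0 (suc (suc h))) i
      ≈⟨ ⋆-cong-≤ i (λ j≤i → X-raise n (suc k) h (ℕ.≤-trans j≤i i≤n))
                    (λ j≤i → X-raise n 0 (suc h) (ℕ.≤-trans j≤i i≤n)) ⟩
    ((λ j → q * δ (X (suc k) h) j) ⋆ (λ j → q * δ (X 0 (suc h)) j)) i
      ≈⟨ ⋆-scaleˡ q (δ (X (suc k) h)) _ i ⟩
    q * (δ (X (suc k) h) ⋆ (λ j → q * δ (X 0 (suc h)) j)) i
      ≈⟨ *-congˡ (⋆-scaleʳ q (δ (X (suc k) h)) (δ (X 0 (suc h))) i) ⟩
    q * (q * (δ (X (suc k) h) ⋆ δ (X 0 (suc h))) i)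
      ≈⟨ *-congˡ (*-congˡ (⋆-dilate q (X (suc k) h) (X 0 (suc h)) i)) ⟩
    q * (q * (q ^ i * (X (suc k) h ⋆ X 0 (suc h)) i))
      ≈⟨ *-congˡ (*-congˡ (*-congˡ (D-X k h i))) ⟨
    q * (q * (q ^ i * X k h (suc i)))
      ≈⟨ *-congˡ (*-assoc _ _ _) ⟨
    q * (q ^ suc i * X k h (suc i)) ∎
    where
    δ : Seq → Seq
    δ = dilate q

  module _ (ι : ℚ → Carrier) (ι-inverse : ∀ n → (n !) · ι (1/ n !) ≈ 1#) where

    open Composition ι ι-inverse

    -- Iterated with `D` outermost, so that `D-composite` for `D^ k φ` yields `D^ (suc k) φ` by
    -- definition.
    D^ : ℕ → Seq → Seq
    D^ zero    x = x
    D^ (suc k) x = D (D^ k x)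

    D^-value : ∀ k x j → D^ k x j ≡ x (j ℕ.+ k)
    D^-value zero    x j = ≡.cong x (≡.sym (ℕ.+-identityʳ j))
    D^-value (suc k) x j = ≡.trans (D^-value k x (suc j)) (≡.cong x (≡.sym (ℕ.+-suc j k)))

    -- Both sides solve y_k′ = q y_{k+1} P′(qt), y_k(0) = φ[k], for P the
    -- series with exponential coefficients x.
    X-composite : ∀ x → x 0 ≈ 0# → D x ≐ X 0 0 →
      ∀ n k {i} → i ≤ n → X k 0 i ≈ q ^ i * composite (D^ k φ) x i
    X-composite x x₀ x′ n k {zero} _ = begin
      X k 0 0                          ≈⟨ X-zero k 0 ⟩
      φ k * 1#                         ≈⟨ *-comm _ _ ⟩
      1# * φ k                         ≡⟨ ≡.cong (1# *_) (D^-value k φ 0) ⟨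
      1# * D^ k φ 0                    ≈⟨ *-congˡ (composite-zero (D^ k φ) x) ⟨
      1# * composite (D^ k φ) x 0      ∎
    X-composite x x₀ x′ (suc n) k {suc i} (s≤s i≤n) = begin
      X k 0 (suc i)
        ≈⟨ D-X k 0 i ⟩
      (X (suc k) 0 ⋆ X 0 1) i
        ≈⟨ ⋆-cong-≤ i (λ j≤i → X-composite x x₀ x′ n (suc k) (ℕ.≤-trans j≤i i≤n))
                      (λ {j} j≤i → trans (X-raise i 0 0 j≤i) (*-congˡ (*-congˡ (sym (x′ j))))) ⟩
      (δ y ⋆ (λ j → q * δ (D x) j)) i
        ≈⟨ ⋆-scaleʳ q (δ y) (δ (D x)) i ⟩
      q * (δ y ⋆ δ (D x)) i
        ≈⟨ *-congˡ (⋆-dilate q y (D x) i) ⟩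
      q * (q ^ i * (y ⋆ D x) i)
        ≈⟨ *-assoc _ _ _ ⟨
      q ^ suc i * (y ⋆ D x) i
        ≈⟨ *-congˡ (D-composite (D^ k φ) x x₀ i) ⟨
      q ^ suc i * composite (D^ k φ) x (suc i) ∎
      where
      y : Seq
      y = composite (D^ (suc k) φ) x

      δ : Seq → Seq
      δ = dilate q

    X-fixpoint : ∀ x → x 0 ≈ 0# → D x ≐ X 0 0 → X 0 0 ≐ (λ n → q ^ n * composite φ x n)
    X-fixpoint x x₀ x′ n = X-composite x x₀ x′ n 0 ℕ.≤-refl

-- Adding a leaf with the largest label to an increasing tree.

module IncreasingTrees where

  open import Data.Nat.Base using (_+_)
  open ≡ using (refl; sym; trans; cong; cong₂; subst; module ≡-Reasoning)

  private
    variable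
      n m : ℕ

  lookup-∷ʳ-inject₁ : ∀ {a} {A : Set a} (xs : Vec A n) x i → lookup (xs ∷ʳᵛ x) (inject₁ i) ≡ lookup xs i
  lookup-∷ʳ-inject₁ (y ∷ᵛ xs) x zero    = refl
  lookup-∷ʳ-inject₁ (y ∷ᵛ xs) x (suc i) = lookup-∷ʳ-inject₁ xs x i

  lookup-∷ʳ-fromℕ : ∀ {a} {A : Set a} (xs : Vec A n) x → lookup (xs ∷ʳᵛ x) (fromℕ n) ≡ x
  lookup-∷ʳ-fromℕ []ᵛ       x = refl
  lookup-∷ʳ-fromℕ (y ∷ᵛ xs) x = lookup-∷ʳ-fromℕ xs x

  lookup-ext : ∀ {a} {A : Set a} (xs ys : Vec A n) → (∀ i → lookup xs i ≡ lookup ys i) → xs ≡ ys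
  lookup-ext xs ys p = trans (sym (Vec.tabulate∘lookup xs)) (trans (Vec.tabulate-cong p) (Vec.tabulate∘lookup ys))

  tabulate-∷ʳ : ∀ {a} {A : Set a} (f : Fin (suc n) → A) → tabulate f ≡ tabulate (f ∘ inject₁) ∷ʳ f (fromℕ n)
  tabulate-∷ʳ {zero}  f = refl
  tabulate-∷ʳ {suc n} f = cong (f zero ∷_) (tabulate-∷ʳ (f ∘ suc))

  addLeaf : ParentMap n → Fin n → ParentMap (suc n)
  addLeaf T v = Vec.map (mapᵐ inject₁) T ∷ʳᵛ just (inject₁ v)

  lookup-addLeaf : (T : ParentMap n) (v w : Fin n) → lookup (addLeaf T v) (inject₁ w) ≡ mapᵐ inject₁ (lookup T w)
  lookup-addLeaf T v w = trans (lookup-∷ʳ-inject₁ (Vec.map (mapᵐ inject₁) T) _ w) (Vec.lookup-map w (mapᵐ inject₁) T)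

  lookup-addLeaf-new : (T : ParentMap n) (v : Fin n) → lookup (addLeaf T v) (fromℕ n) ≡ just (inject₁ v)
  lookup-addLeaf-new T v = lookup-∷ʳ-fromℕ (Vec.map (mapᵐ inject₁) T) _

  -- `ancestor` takes its last step at the top; peeling off the bottom edge instead allows induction
  -- along the path that starts at the parent.
  ancestor-suc : (T : ParentMap n) → ∀ k w → ancestor T (suc k) w ≡ (lookup T w >>= ancestor T k)
  ancestor-suc T zero w with lookup T w
  ... | nothing = refl
  ... | just _  = refl
  ancestor-suc T (suc k) w = trans (cong (_>>= lookup T) (ancestor-suc T k w)) (assoc (lookup T w))
    where
    assoc : ∀ x → ((x >>= ancestor T k) >>= lookup T) ≡ (x >>= ancestor T (suc k))
    assoc nothing  = refl
    assoc (just _) = refl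

  ancestor-addLeaf : (T : ParentMap n) (v : Fin n) → ∀ k w →
                     ancestor (addLeaf T v) k (inject₁ w) ≡ mapᵐ inject₁ (ancestor T k w)
  ancestor-addLeaf T v zero    w = refl
  ancestor-addLeaf T v (suc k) w rewrite ancestor-addLeaf T v k w with ancestor T k w
  ... | nothing = refl
  ... | just u  = lookup-addLeaf T v u

  ancestor-addLeaf-new : (T : ParentMap n) (v : Fin n) → ∀ k →
                         ancestor (addLeaf T v) (suc k) (fromℕ n) ≡ mapᵐ inject₁ (ancestor T k v)
  ancestor-addLeaf-new T v k = trans (ancestor-suc (addLeaf T v) k _)
    (trans (cong (_>>= ancestor (addLeaf T v) k) (lookup-addLeaf-new T v)) (ancestor-addLeaf T v k v))

  mapᵐ-just⁻ : ∀ {a b} {A : Set a} {B : Set b} {f : A → B} (x : Maybe A) {y} → mapᵐ f x ≡ just y → ∃ λ z → x ≡ just z × y ≡ f z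
  mapᵐ-just⁻ (just z) refl = z , refl , refl

  addLeaf-isIncreasingTree : {T : ParentMap n} → IsIncreasingTree T → ∀ v → IsIncreasingTree (addLeaf T v)
  addLeaf-isIncreasingTree {n} {T} t v = record
    { isRootedTree = record
      { root     = inject₁ t.root
      ; orphaned = trans (lookup-addLeaf T v t.root) (cong (mapᵐ inject₁) t.orphaned)
      ; path     = λ w → path (view w)
      }
    ; isIncreasing = λ k u w → increasing k (view w)
    }
    where
    module t = IsIncreasingTree t

    path : ∀ {w} → View w → ∃ λ k → ancestor (addLeaf T v) k w ≡ just (inject₁ t.root)
    path ‵fromℕ       = let k , eq = t.path v in suc k , trans (ancestor-addLeaf-new T v k) (cong (mapᵐ inject₁) eq)
    path (‵inject₁ w) = let k , eq = t.path w in k , trans (ancestor-addLeaf T v k w) (cong (mapᵐ inject₁) eq)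

    increasing : ∀ k {u w} → View w → ancestor (addLeaf T v) (suc k) w ≡ just u → u <ᶠ w
    increasing k ‵fromℕ eq with mapᵐ-just⁻ (ancestor T k v) (trans (sym (ancestor-addLeaf-new T v k)) eq)
    ... | u′ , _ , refl = subst (toℕ (inject₁ u′) <_) (sym (Fin.toℕ-fromℕ n)) (Fin.inject₁ℕ< u′)
    increasing k (‵inject₁ w) eq with mapᵐ-just⁻ (ancestor T (suc k) w) (trans (sym (ancestor-addLeaf T v (suc k) w)) eq)
    ... | u′ , eq′ , refl = subst (_< toℕ (inject₁ w)) (sym (Fin.toℕ-inject₁ u′))
                              (subst (toℕ u′ <_) (sym (Fin.toℕ-inject₁ w)) (t.isIncreasing k u′ w eq′))

  addLeafTree : IncreasingTree n → Fin n → IncreasingTree (suc n)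
  addLeafTree T v = record
    { parents = addLeaf (parents T) v ; isIncreasingTree = addLeaf-isIncreasingTree (isIncreasingTree T) v }

  singleton : IncreasingTree 1
  singleton = record
    { parents          = nothing ∷ᵛ []ᵛ
    ; isIncreasingTree = record
      { isRootedTree = record { root = zero ; orphaned = refl ; path = λ { zero → 0 , refl } }
      ; isIncreasing = λ { k v zero eq → contradiction (trans (sym eq) (ancestor-suc (nothing ∷ᵛ []ᵛ) k zero)) λ () }
      }
    }

  -- Outdegrees and heights after adding a leaf.

  depth-unique : (T : ParentMap n) → ∀ k k′ {v r r′} → lookup T r ≡ nothing → lookup T r′ ≡ nothing →
                 ancestor T k v ≡ just r → ancestor T k′ v ≡ just r′ → k ≡ k′
  depth-unique T zero    zero     o o′ a a′ = refl
  depth-unique T zero    (suc k′) {r = r} o o′ refl a′ = contradiction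
    (trans (sym a′) (trans (ancestor-suc T k′ r) (cong (_>>= ancestor T k′) o))) λ ()
  depth-unique T (suc k) zero     {r′ = r′} o o′ a refl = contradiction
    (trans (sym a) (trans (ancestor-suc T k r′) (cong (_>>= ancestor T k) o′))) λ ()
  depth-unique T (suc k) (suc k′) {v} o o′ a a′
    with lookup T v | trans (sym (ancestor-suc T k v)) a | trans (sym (ancestor-suc T k′ v)) a′
  ... | just u | b | b′ = cong suc (depth-unique T k k′ o o′ b b′)

  -- `height` is read off the witness `path` and might vary with the proof. It does not, since every
  -- chain of ancestors stops at a parentless vertex.
  height-unique : (T : IncreasingTree n) → ∀ k {v r} → lookup (parents T) r ≡ nothing →
                  ancestor (parents T) k v ≡ just r → height T v ≡ k
  height-unique T k {v} o a = depth-unique (parents T) (height T v) k orphaned o (proj₂ (path v)) a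
    where open IncreasingTree T using (orphaned; path)

  vertex : IncreasingTree n → Fin n → Vertex
  vertex T v = length (children T v) , height T v

  vertices : IncreasingTree n → List Vertex
  vertices T = tabulate (vertex T)

  vertices-cong : (T T′ : IncreasingTree n) → parents T ≡ parents T′ → vertices T ≡ vertices T′
  vertices-cong T T′ refl = tabulate-cong λ v → cong (length (children T v) ,_)
    (height-unique T _ (IncreasingTree.orphaned T′) (proj₂ (IncreasingTree.path T′ v)))

  length-filter-map : ∀ {a b p} {A : Set a} {B : Set b} {P : Pred B p} (P? : Decidable P) (f : A → B) xs →
                      length (filter P? (map f xs)) ≡ length (filter (P? ∘ f) xs)
  length-filter-map P? f []       = refl
  length-filter-map P? f (x ∷ xs) with does (P? (f x))
  ... | true  = cong suc (length-filter-map P? f xs)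
  ... | false = length-filter-map P? f xs

  isChild? : (T : ParentMap n) (v : Fin n) → Decidable (λ w → lookup T w ≡ just v)
  isChild? T v w = Maybe.≡-dec Fin._≟_ (lookup T w) (just v)

  -- The candidates for a child are the old vertices and the new leaf; counting them apart leaves
  -- the second summand as the only possible change.
  length-children-addLeaf : (T : IncreasingTree n) → ∀ v u → length (children (addLeafTree T v) u) ≡
    length (filter (isChild? (parents (addLeafTree T v)) u ∘ inject₁) (allFin n)) +
    length (filter (isChild? (parents (addLeafTree T v)) u) [ fromℕ n ])
  length-children-addLeaf {n} T v u = begin
    length (filter C? (allFin (suc n)))
      ≡⟨ cong (length ∘ filter C?) (trans (tabulate-∷ʳ (λ w → w)) (cong (_∷ʳ fromℕ n) (sym (map-tabulate (λ w → w) inject₁)))) ⟩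
    length (filter C? (map inject₁ (allFin n) ∷ʳ fromℕ n))
      ≡⟨ cong length (filter-++ C? (map inject₁ (allFin n)) _) ⟩
    length (filter C? (map inject₁ (allFin n)) ++ filter C? [ fromℕ n ])
      ≡⟨ length-++ (filter C? (map inject₁ (allFin n))) ⟩
    length (filter C? (map inject₁ (allFin n))) + length (filter C? [ fromℕ n ])
      ≡⟨ cong (_+ length (filter C? [ fromℕ n ])) (length-filter-map C? inject₁ (allFin n)) ⟩
    length (filter (C? ∘ inject₁) (allFin n)) + length (filter C? [ fromℕ n ]) ∎
    where
    open ≡-Reasoning
    C? = isChild? (parents (addLeafTree T v)) u

  outdegree-old : (T : IncreasingTree n) → ∀ v u →
                  length (filter (isChild? (parents (addLeafTree T v)) (inject₁ u) ∘ inject₁) (allFin n)) ≡ length (children T u)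
  outdegree-old {n} T v u = cong length (filter-≐ _ (isChild? (parents T) u) (to , from) (allFin n))
    where
    to : ∀ {w} → lookup (addLeaf (parents T) v) (inject₁ w) ≡ just (inject₁ u) → lookup (parents T) w ≡ just u
    to {w} eq with mapᵐ-just⁻ (lookup (parents T) w) (trans (sym (lookup-addLeaf (parents T) v w)) eq)
    ... | u′ , eq′ , eq″ = trans eq′ (cong just (sym (Fin.inject₁-injective eq″)))

    from : ∀ {w} → lookup (parents T) w ≡ just u → lookup (addLeaf (parents T) v) (inject₁ w) ≡ just (inject₁ u)
    from {w} eq = trans (lookup-addLeaf (parents T) v w) (cong (mapᵐ inject₁) eq)

  vertex-addLeaf : (T : IncreasingTree n) → ∀ v w →
                   vertex (addLeafTree T v) (inject₁ w) ≡ updateAt (vertex T) v gainChild w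
  vertex-addLeaf {n} T v w = trans (cong₂ _,_ outdegree height≡) (split (v Fin.≟ w))
    where
    T′ = addLeafTree T v

    outdegree : length (children T′ (inject₁ w)) ≡
                length (children T w) + length (filter (isChild? (parents T′) (inject₁ w)) [ fromℕ n ])
    outdegree = trans (length-children-addLeaf T v (inject₁ w))
      (cong (_+ length (filter (isChild? (parents T′) (inject₁ w)) [ fromℕ n ])) (outdegree-old T v w))

    height≡ : height T′ (inject₁ w) ≡ height T w
    height≡ = height-unique T′ (height T w) (IncreasingTree.orphaned T′)
      (trans (ancestor-addLeaf (parents T) v (height T w) w) (cong (mapᵐ inject₁) (proj₂ (IncreasingTree.path T w))))

    split : ∀ {w} → Dec (v ≡ w) →
            (length (children T w) + length (filter (isChild? (parents T′) (inject₁ w)) [ fromℕ n ]) , height T w) ≡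
            updateAt (vertex T) v gainChild w
    split {w} (yes refl) = trans
      (cong (_, height T v) (trans
        (cong (λ xs → length (children T v) + length xs)
          (filter-accept (isChild? (parents T′) (inject₁ w)) {xs = []} (lookup-addLeaf-new (parents T) v)))
        (ℕ.+-comm _ 1)))
      (sym (updateAt-updates v (vertex T)))
    split {w} (no v≢w) = trans
      (cong (_, height T w) (trans
        (cong (λ xs → length (children T w) + length xs) (filter-reject (isChild? (parents T′) (inject₁ w)) {xs = []}
          (λ eq → v≢w (Fin.inject₁-injective (Maybe.just-injective (trans (sym (lookup-addLeaf-new (parents T) v)) eq))))))
        (ℕ.+-identityʳ _)))
      (sym (updateAt-minimal w v (vertex T) (v≢w ∘ sym)))

  vertex-addLeaf-new : (T : IncreasingTree n) → ∀ v → vertex (addLeafTree T v) (fromℕ n) ≡ newChild (vertex T v)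
  vertex-addLeaf-new {n} T v = cong₂ _,_
    (trans (length-children-addLeaf T v (fromℕ n)) (cong₂ (λ xs ys → length xs + length ys) old new))
    (height-unique T′ (suc (height T v)) (IncreasingTree.orphaned T′)
      (trans (ancestor-addLeaf-new (parents T) v (height T v)) (cong (mapᵐ inject₁) (proj₂ (IncreasingTree.path T v)))))
    where
    T′ = addLeafTree T v

    old : filter (isChild? (parents T′) (fromℕ n) ∘ inject₁) (allFin n) ≡ []
    old = filter-none _ (All.universal (λ w eq →
      let _ , _ , eq′ = mapᵐ-just⁻ (lookup (parents T) w) (trans (sym (lookup-addLeaf (parents T) v w)) eq)
      in Fin.fromℕ≢inject₁ eq′) (allFin n))

    new : filter (isChild? (parents T′) (fromℕ n)) [ fromℕ n ] ≡ []
    new = filter-reject (isChild? (parents T′) (fromℕ n)) {xs = []}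
      (λ eq → Fin.fromℕ≢inject₁ (sym (Maybe.just-injective (trans (sym (lookup-addLeaf-new (parents T) v)) eq))))

  vertices-addLeaf : (T : IncreasingTree n) → ∀ v →
                     vertices (addLeafTree T v) ≡ tabulate (updateAt (vertex T) v gainChild) ∷ʳ newChild (vertex T v)
  vertices-addLeaf T v = trans (tabulate-∷ʳ (vertex (addLeafTree T v)))
    (cong₂ _∷ʳ_ (tabulate-cong (vertex-addLeaf T v)) (vertex-addLeaf-new T v))

  -- Increasing trees correspond to growth histories.

  -- The successive parents of the leaves added to a single vertex.
  data History : ℕ → Set where
    start : History 0
    grow  : History m → Fin (suc m) → History (suc m)

  tree : History m → IncreasingTree (suc m)
  tree start      = singleton
  tree (grow r v) = addLeafTree (tree r) v

  histories : (m : ℕ) → List (History m)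
  histories zero    = [ start ]
  histories (suc m) = cartesianProductWith grow (histories m) (allFin (suc m))

  histories-complete : (r : History m) → r ∈ histories m
  histories-complete start      = here refl
  histories-complete (grow r v) = ∈-cartesianProductWith⁺ grow (histories-complete r) (∈-allFin v)

  histories-unique : ∀ m → Unique (histories m)
  histories-unique zero    = All.[] ∷ []
  histories-unique (suc m) =
    Unique.cartesianProductWith⁺ grow (λ { refl → refl , refl }) (histories-unique m) (Unique.allFin⁺ (suc m))

  -- The last entry of the parent map reveals the last chosen parent, and the other entries are
  -- those of the earlier tree.
  tree-injective : (r r′ : History m) → parents (tree r) ≡ parents (tree r′) → r ≡ r′
  tree-injective start      start        eq = refl
  tree-injective (grow r v) (grow r′ v′) eq = cong₂ grow
    (tree-injective r r′ (lookup-ext _ _ λ w → Maybe.map-injective Fin.inject₁-injective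
      (trans (sym (lookup-addLeaf (parents (tree r)) v w))
        (trans (cong (λ T → lookup T (inject₁ w)) eq) (lookup-addLeaf (parents (tree r′)) v′ w)))))
    (Fin.inject₁-injective (Maybe.just-injective
      (trans (sym (lookup-addLeaf-new (parents (tree r)) v))
        (trans (cong (λ T → lookup T (fromℕ _)) eq) (lookup-addLeaf-new (parents (tree r′)) v′)))))

  -- An entrywise description of increasing trees. It survives the removal of the largest label
  -- directly, whereas the paths of `IsRootedTree` would have to be rebuilt.
  HasSmallerParent : ParentMap (suc m) → Fin (suc m) → Set
  HasSmallerParent T w = (w ≡ zero × lookup T w ≡ nothing) ⊎ ∃ λ v → v <ᶠ w × lookup T w ≡ just v

  -- The path from a parentless vertex to the root has no step, so that vertex is the root. The path
  -- from `zero` has none either, since a step would lead to a smaller label.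
  hasSmallerParent : (T : IncreasingTree (suc m)) → ∀ w → HasSmallerParent (parents T) w
  hasSmallerParent T w with lookup (parents T) w in eq
  ... | just v  = inj₂ (v , IncreasingTree.isIncreasing T 0 v w eq , refl)
  ... | nothing = inj₁ (trans w≡root (sym zero≡root) , refl)
    where
    open IncreasingTree T using (root; orphaned; path; isIncreasing)

    w≡root : w ≡ root
    w≡root with path w
    ... | zero  , refl = refl
    ... | suc k , a    = contradiction
      (trans (sym a) (trans (ancestor-suc (parents T) k w) (cong (_>>= ancestor (parents T) k) eq))) λ ()

    zero≡root : zero ≡ root
    zero≡root with path zero
    ... | zero  , refl = refl
    ... | suc k , a    = contradiction (isIncreasing k root zero a) λ ()

  lower : {v : Fin (suc n)} → View v → (w : Fin (suc n)) → v <ᶠ w → ∃ λ u → v ≡ inject₁ u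
  lower {n} ‵fromℕ       w v<w = contradiction (subst (_< toℕ w) (Fin.toℕ-fromℕ n) v<w) (ℕ.≤⇒≯ (Fin.toℕ≤pred[n] w))
  lower     (‵inject₁ u) w v<w = u , refl

  -- Parents being smaller, nothing hangs from the largest label. Deleting it leaves entries that
  -- all lie in the smaller range, and its own parent is the last choice of the history.
  history : (T : ParentMap (suc m)) → (∀ w → HasSmallerParent T w) → ∃ λ r → parents (tree {m} r) ≡ T
  history {zero}  (x ∷ᵛ []ᵛ) p with p zero
  ... | inj₁ (_ , refl) = start , refl
  ... | inj₂ (_ , () , _)
  history {suc m} T p with p (fromℕ (suc m))
  -- The other alternative is impossible, as `fromℕ (suc m)` is not `zero`.
  ... | inj₂ (v , v<w , eqᵥ) with lower (view v) (fromℕ (suc m)) v<w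
  ... | v′ , refl = grow (proj₁ r) v′ , lookup-ext _ T (λ w → agree (view w))
    where
    old : ∀ w → ∃ λ x → lookup T (inject₁ w) ≡ mapᵐ inject₁ x ×
                        ((w ≡ zero × x ≡ nothing) ⊎ ∃ λ u → u <ᶠ w × x ≡ just u)
    old w with p (inject₁ w)
    ... | inj₁ (w≡0 , eq) = nothing , eq , inj₁ (Fin.inject₁-injective w≡0 , refl)
    ... | inj₂ (u , u<w , eq) with lower (view u) (inject₁ w) u<w
    ... | u′ , refl = just u′ , eq , inj₂ (u′ , subst (toℕ u′ <_) (Fin.toℕ-inject₁ w)
      (subst (_< toℕ (inject₁ w)) (Fin.toℕ-inject₁ u′) u<w) , refl)

    T₀ : ParentMap (suc m)
    T₀ = Vec.tabulate (proj₁ ∘ old)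

    smaller₀ : ∀ w → HasSmallerParent T₀ w
    smaller₀ w rewrite Vec.lookup∘tabulate (proj₁ ∘ old) w = proj₂ (proj₂ (old w))

    r : ∃ λ r → parents (tree r) ≡ T₀
    r = history T₀ smaller₀

    agree : ∀ {w} → View w → lookup (addLeaf (parents (tree (proj₁ r))) v′) w ≡ lookup T w
    agree ‵fromℕ       = trans (lookup-addLeaf-new (parents (tree (proj₁ r))) v′) (sym eqᵥ)
    agree (‵inject₁ w) = trans (lookup-addLeaf (parents (tree (proj₁ r))) v′ w)
      (trans (cong (λ M → mapᵐ inject₁ (lookup M w)) (proj₂ r))
        (trans (cong (mapᵐ inject₁) (Vec.lookup∘tabulate (proj₁ ∘ old) w)) (sym (proj₁ (proj₂ (old w))))))

  -- Two lists without repetition and with the same members are permutations of each other. Parent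
  -- maps are compared because two trees with the same parent map may differ in their proofs.
  increasingTrees-↭ : ∀ m → map parents (increasingTrees (suc m)) ↭ map parents (map tree (histories m))
  increasingTrees-↭ m = ∼bag⇒↭ (unique∧set⇒bag (increasingTrees-unique (suc m))
    (subst Unique (map-∘ (histories m)) (Unique.map⁺ (λ {r} {r′} → tree-injective r r′) (histories-unique m)))
    (mk⇔ to from))
    where
    to : ∀ {M} → M ∈ map parents (increasingTrees (suc m)) → M ∈ map parents (map tree (histories m))
    to M∈ with ∈-map⁻ parents M∈
    ... | T , _ , refl with history (parents T) (hasSmallerParent T)
    ... | r , eq = subst (_∈ _) eq (∈-map⁺ parents (∈-map⁺ tree (histories-complete r)))

    from : ∀ {M} → M ∈ map parents (map tree (histories m)) → M ∈ map parents (increasingTrees (suc m))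
    from M∈ with ∈-map⁻ parents M∈
    ... | T , _ , refl = increasingTrees-complete T

  -- Summing the weights of all increasing trees.

  module TreeSum {a ℓ} (A : CommutativeRing a ℓ) (φ : ℕ → CommutativeRing.Carrier A) (q : CommutativeRing.Carrier A) where

    private module A = CommutativeRing A
    open A using (Carrier; _≈_; 0#)
    open ListSum A
    open Growth A φ q

    ∑-cartesianProductWith : ∀ {b c d} {B : Set b} {C : Set c} {E : Set d} (g : E → Carrier) (f : B → C → E) xs ys →
      ∑ g (cartesianProductWith f xs ys) ≈ ∑ (λ x → ∑ (λ y → g (f x y)) ys) xs
    ∑-cartesianProductWith g f []       ys = A.refl
    ∑-cartesianProductWith g f (x ∷ xs) ys = A.trans (∑-++ g (map (f x) ys) _)
      (A.+-cong (∑-map g (f x) ys) (∑-cartesianProductWith g f xs ys))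

    -- The permutation lives on parent maps, so `g` is first factored through them.
    ∑-parents : (g : IncreasingTree n → Carrier) → (∀ T T′ → parents T ≡ parents T′ → g T ≈ g T′) →
                ∀ {Ts Ts′} → map parents Ts ↭ map parents Ts′ → ∑ g Ts ≈ ∑ g Ts′
    ∑-parents {n} g g-cong {Ts} {Ts′} p = A.trans (via Ts) (A.trans (∑-↭ g′ p) (A.sym (via Ts′)))
      where
      g′ : ParentMap n → Carrier
      g′ M with increasingTree? M
      ... | yes t = g (record { parents = M ; isIncreasingTree = t })
      -- A default that the sums never meet: their parent maps all come from trees.
      ... | no  _ = 0#

      g≈g′ : ∀ T → g T ≈ g′ (parents T)
      g≈g′ T with increasingTree? (parents T)
      ... | yes t = g-cong T _ refl
      ... | no ¬t = contradiction (isIncreasingTree T) ¬t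

      via : ∀ Ts → ∑ g Ts ≈ ∑ g′ (map parents Ts)
      via Ts = A.trans (∑-cong g≈g′ Ts) (A.sym (∑-map g′ parents Ts))

    -- Of the `m + n` vertices added to the root, `m` are recorded in the history and `n` are left
    -- to `W`. The induction hands them over to `W` one at a time; at `n = 0` the plain weights of
    -- the trees are summed.
    ∑-histories : ∀ m n → ∑ (λ r → W (vertices (tree r)) n) (histories m) ≈ X 0 0 (m + n)
    ∑-histories zero    n = A.+-identityʳ _
    ∑-histories (suc m) n = begin
      ∑ (λ r → W (vertices (tree r)) n) (histories (suc m))
        ≈⟨ ∑-cartesianProductWith (λ r → W (vertices (tree r)) n) grow (histories m) (allFin (suc m)) ⟩
      ∑ (λ r → ∑ (λ v → W (vertices (tree (grow r v))) n) (allFin (suc m))) (histories m)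
        ≈⟨ ∑-cong leaf (histories m) ⟩
      ∑ (λ r → W (vertices (tree r)) (suc n)) (histories m)
        ≈⟨ ∑-histories m (suc n) ⟩
      X 0 0 (m + suc n)
        ≡⟨ cong (X 0 0) (ℕ.+-suc m n) ⟩
      X 0 0 (suc m + n) ∎
      where
      open import Relation.Binary.Reasoning.Setoid A.setoid

      leaf : ∀ r → ∑ (λ v → W (vertices (tree (grow r v))) n) (allFin (suc m)) ≈ W (vertices (tree r)) (suc n)
      leaf r = begin
        ∑ (λ v → W (vertices (tree (grow r v))) n) (allFin (suc m))
          ≡⟨ cong (foldr A._+_ 0#) (map-tabulate {n = suc m} (λ v → v) (λ v → W (vertices (tree (grow r v))) n)) ⟩
        foldr A._+_ 0# (tabulate (λ v → W (vertices (addLeafTree (tree r) v)) n))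
          ≡⟨ cong (foldr A._+_ 0#) (tabulate-cong λ v → cong (λ L → W L n) (vertices-addLeaf (tree r) v)) ⟩
        foldr A._+_ 0# (tabulate (λ v → W (tabulate (updateAt (vertex (tree r)) v gainChild) ∷ʳ newChild (vertex (tree r) v)) n))
          ≈⟨ ∑-growths-tabulate (λ L → W L n) (λ p → W-↭ p n) (vertex (tree r)) ⟨
        W (vertices (tree r)) (suc n) ∎

    ∑-increasingTrees : ∀ m → ∑ (λ T → weights (vertices T)) (increasingTrees (suc m)) ≈ X 0 0 m
    ∑-increasingTrees m = begin
      ∑ (λ T → weights (vertices T)) (increasingTrees (suc m))
        ≈⟨ ∑-parents (λ T → weights (vertices T)) (λ T T′ eq → A.reflexive (cong weights (vertices-cong T T′ eq)))
             (increasingTrees-↭ m) ⟩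
      ∑ (λ T → weights (vertices T)) (map tree (histories m))
        ≈⟨ ∑-map (λ T → weights (vertices T)) tree (histories m) ⟩
      ∑ (λ r → weights (vertices (tree r))) (histories m)
        ≈⟨ ∑-histories m 0 ⟩
      X 0 0 (m + 0)
        ≡⟨ cong (X 0 0) (ℕ.+-identityʳ m) ⟩
      X 0 0 m ∎
      where open import Relation.Binary.Reasoning.Setoid A.setoid

-- Laurent polynomials form a commutative ring.

module LaurentRing {c ℓ} (R : CommutativeRing c ℓ) where

  open CommutativeRing R hiding (zero)
  open GroupProperties (CommutativeRing.+-group ℤ.+-*-commutativeRing) using (\\-leftDividesˡ; \\-leftDividesʳ)
  open RingProperties ring using (-0#≈0#; -‿+-comm)
  open CommutativeSemigroupProperties +-commutativeSemigroup using () renaming (interchange to +-interchange)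
  open CommutativeSemigroupProperties *-commutativeSemigroup using (x∙yz≈y∙xz)
  open SetoidReasoning setoid
  open LaurentPolynomials rawRing public

  private
    module L where
      open RawRing laurent public
      open RawSemiringDefs (RawRing.rawSemiring laurent) public using (_^_)

  -- Pairing with u : ℤ → R extends qⁱ ↦ u i linearly; unlike the list of
  -- coefficients, it takes a simple form on products.
  ⟨_,_⟩ : Laurent → (ℤ → Carrier) → Carrier
  ⟨ []          , u ⟩ = 0#
  ⟨ (i , x) ∷ f , u ⟩ = x * u i + ⟨ f , u ⟩

  δ : ℤ → ℤ → Carrier
  δ k i = if does (i ℤ.≟ k) then 1# else 0#

  ⟨,⟩-cong : ∀ f {u v} → (∀ i → u i ≈ v i) → ⟨ f , u ⟩ ≈ ⟨ f , v ⟩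
  ⟨,⟩-cong []            p = refl
  ⟨,⟩-cong ((i , x) ∷ f) p = +-cong (*-congˡ (p i)) (⟨,⟩-cong f p)

  ⟨,⟩-++ : ∀ f g u → ⟨ f ++ g , u ⟩ ≈ ⟨ f , u ⟩ + ⟨ g , u ⟩
  ⟨,⟩-++ []            g u = sym (+-identityˡ _)
  ⟨,⟩-++ ((i , x) ∷ f) g u = trans (+-congˡ (⟨,⟩-++ f g u)) (sym (+-assoc _ _ _))

  ⟨,⟩-zeroʳ : ∀ f → ⟨ f , (λ _ → 0#) ⟩ ≈ 0#
  ⟨,⟩-zeroʳ []            = refl
  ⟨,⟩-zeroʳ ((i , x) ∷ f) = trans (+-cong (zeroʳ _) (⟨,⟩-zeroʳ f)) (+-identityˡ _)

  ⟨,⟩-+ʳ : ∀ f u v → ⟨ f , (λ i → u i + v i) ⟩ ≈ ⟨ f , u ⟩ + ⟨ f , v ⟩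
  ⟨,⟩-+ʳ []            u v = sym (+-identityˡ _)
  ⟨,⟩-+ʳ ((i , x) ∷ f) u v = trans (+-cong (distribˡ _ _ _) (⟨,⟩-+ʳ f u v)) (+-interchange _ _ _ _)

  ⟨,⟩-*ʳ : ∀ f x u → ⟨ f , (λ i → x * u i) ⟩ ≈ x * ⟨ f , u ⟩
  ⟨,⟩-*ʳ []            x u = sym (zeroʳ _)
  ⟨,⟩-*ʳ ((i , y) ∷ f) x u = trans (+-cong (x∙yz≈y∙xz _ _ _) (⟨,⟩-*ʳ f x u)) (sym (distribˡ _ _ _))

  ⟨,⟩-swap : ∀ f g (u : ℤ → ℤ → Carrier) → ⟨ f , (λ i → ⟨ g , u i ⟩) ⟩ ≈ ⟨ g , (λ j → ⟨ f , (λ i → u i j) ⟩) ⟩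
  ⟨,⟩-swap []            g u = sym (⟨,⟩-zeroʳ g)
  ⟨,⟩-swap ((i , x) ∷ f) g u = begin
    x * ⟨ g , u i ⟩ + ⟨ f , (λ i → ⟨ g , u i ⟩) ⟩
      ≈⟨ +-cong (sym (⟨,⟩-*ʳ g x (u i))) (⟨,⟩-swap f g u) ⟩
    ⟨ g , (λ j → x * u i j) ⟩ + ⟨ g , (λ j → ⟨ f , (λ i → u i j) ⟩) ⟩
      ≈⟨ ⟨,⟩-+ʳ g _ _ ⟨
    ⟨ g , (λ j → x * u i j + ⟨ f , (λ i → u i j) ⟩) ⟩ ∎

  ⟨,⟩-* : ∀ f g u → ⟨ f L.* g , u ⟩ ≈ ⟨ f , (λ i → ⟨ g , (λ j → u (i +ℤ j)) ⟩) ⟩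
  ⟨,⟩-* []            g u = refl
  ⟨,⟩-* ((i , x) ∷ f) g u = trans (⟨,⟩-++ (map _ g) (f L.* g) u) (+-cong (row g) (⟨,⟩-* f g u))
    where
    row : ∀ g → ⟨ map (λ (j , y) → i +ℤ j , x * y) g , u ⟩ ≈ x * ⟨ g , (λ j → u (i +ℤ j)) ⟩
    row []            = sym (zeroʳ _)
    row ((j , y) ∷ g) = trans (+-cong (*-assoc _ _ _) (row g)) (sym (distribˡ _ _ _))

  coefficient≈⟨,δ⟩ : ∀ f k → coefficient f k ≈ ⟨ f , δ k ⟩
  coefficient≈⟨,δ⟩ []            k = refl
  coefficient≈⟨,δ⟩ ((i , x) ∷ f) k with i ℤ.≟ k
  ... | yes _ = +-cong (sym (*-identityʳ _)) (coefficient≈⟨,δ⟩ f k)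
  ... | no  _ = trans (coefficient≈⟨,δ⟩ f k) (sym (trans (+-congʳ (zeroʳ _)) (+-identityˡ _)))

  -- Coefficients are the pairings with `δ k`. Ring laws can thus be checked against an arbitrary
  -- `u`, where they reduce to laws for the exponents in ℤ.
  ⟨,⟩⇒≈ : ∀ {f g} → (∀ u → ⟨ f , u ⟩ ≈ ⟨ g , u ⟩) → f L.≈ g
  ⟨,⟩⇒≈ {f} {g} p k = trans (coefficient≈⟨,δ⟩ f k) (trans (p (δ k)) (sym (coefficient≈⟨,δ⟩ g k)))

  δ-shift : ∀ k i j → δ k (i +ℤ j) ≡ δ (-ℤ i +ℤ k) j
  δ-shift k i j with (i +ℤ j) ℤ.≟ k | j ℤ.≟ (-ℤ i +ℤ k)
  ... | yes _ | yes _ = ≡.refl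
  ... | no  _ | no  _ = ≡.refl
  ... | yes p | no ¬q = contradiction (≡.trans (≡.sym (\\-leftDividesʳ i j)) (≡.cong (-ℤ i +ℤ_) p)) ¬q
  ... | no ¬p | yes q = contradiction (≡.trans (≡.cong (i +ℤ_) q) (\\-leftDividesˡ i k)) ¬p

  -- The product acts on lists while equality compares coefficients. Here `g` enters only through
  -- its coefficients, so the product respects equality on the right, and by commutativity on the
  -- left.
  coefficient-* : ∀ f g k → coefficient (f L.* g) k ≈ ⟨ f , (λ i → coefficient g (-ℤ i +ℤ k)) ⟩
  coefficient-* f g k = begin
    coefficient (f L.* g) k                          ≈⟨ coefficient≈⟨,δ⟩ (f L.* g) k ⟩
    ⟨ f L.* g , δ k ⟩                                ≈⟨ ⟨,⟩-* f g (δ k) ⟩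
    ⟨ f , (λ i → ⟨ g , (λ j → δ k (i +ℤ j)) ⟩) ⟩     ≈⟨ ⟨,⟩-cong f (λ i → ⟨,⟩-cong g (λ j → reflexive (δ-shift k i j))) ⟩
    ⟨ f , (λ i → ⟨ g , δ (-ℤ i +ℤ k) ⟩) ⟩            ≈⟨ ⟨,⟩-cong f (λ i → coefficient≈⟨,δ⟩ g (-ℤ i +ℤ k)) ⟨
    ⟨ f , (λ i → coefficient g (-ℤ i +ℤ k)) ⟩        ∎

  coefficient-++ : ∀ f g k → coefficient (f ++ g) k ≈ coefficient f k + coefficient g k
  coefficient-++ f g k = begin
    coefficient (f ++ g) k              ≈⟨ coefficient≈⟨,δ⟩ (f ++ g) k ⟩
    ⟨ f ++ g , δ k ⟩                    ≈⟨ ⟨,⟩-++ f g (δ k) ⟩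
    ⟨ f , δ k ⟩ + ⟨ g , δ k ⟩           ≈⟨ +-cong (coefficient≈⟨,δ⟩ f k) (coefficient≈⟨,δ⟩ g k) ⟨
    coefficient f k + coefficient g k   ∎

  coefficient-neg : ∀ f k → coefficient (L.- f) k ≈ - coefficient f k
  coefficient-neg []            k = sym -0#≈0#
  coefficient-neg ((i , x) ∷ f) k with i ℤ.≟ k
  ... | yes _ = trans (+-congˡ (coefficient-neg f k)) (-‿+-comm _ _)
  ... | no  _ = coefficient-neg f k

  *ᴸ-comm : ∀ f g → f L.* g L.≈ g L.* f
  *ᴸ-comm f g = ⟨,⟩⇒≈ {f L.* g} {g L.* f} λ u → begin
    ⟨ f L.* g , u ⟩                                ≈⟨ ⟨,⟩-* f g u ⟩
    ⟨ f , (λ i → ⟨ g , (λ j → u (i +ℤ j)) ⟩) ⟩     ≈⟨ ⟨,⟩-swap f g (λ i j → u (i +ℤ j)) ⟩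
    ⟨ g , (λ j → ⟨ f , (λ i → u (i +ℤ j)) ⟩) ⟩     ≈⟨ ⟨,⟩-cong g (λ j → ⟨,⟩-cong f (λ i → reflexive (≡.cong u (ℤ.+-comm i j)))) ⟩
    ⟨ g , (λ j → ⟨ f , (λ i → u (j +ℤ i)) ⟩) ⟩     ≈⟨ ⟨,⟩-* g f u ⟨
    ⟨ g L.* f , u ⟩                                ∎

  *ᴸ-assoc : ∀ f g h → (f L.* g) L.* h L.≈ f L.* (g L.* h)
  *ᴸ-assoc f g h = ⟨,⟩⇒≈ {(f L.* g) L.* h} {f L.* (g L.* h)} λ u → begin
    ⟨ (f L.* g) L.* h , u ⟩
      ≈⟨ ⟨,⟩-* (f L.* g) h u ⟩
    ⟨ f L.* g , (λ i → ⟨ h , (λ k → u (i +ℤ k)) ⟩) ⟩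
      ≈⟨ ⟨,⟩-* f g _ ⟩
    ⟨ f , (λ i → ⟨ g , (λ j → ⟨ h , (λ k → u (i +ℤ j +ℤ k)) ⟩) ⟩) ⟩
      ≈⟨ ⟨,⟩-cong f (λ i → ⟨,⟩-cong g (λ j → ⟨,⟩-cong h (λ k → reflexive (≡.cong u (ℤ.+-assoc i j k))))) ⟩
    ⟨ f , (λ i → ⟨ g , (λ j → ⟨ h , (λ k → u (i +ℤ (j +ℤ k))) ⟩) ⟩) ⟩
      ≈⟨ ⟨,⟩-cong f (λ i → ⟨,⟩-* g h (λ j → u (i +ℤ j))) ⟨
    ⟨ f , (λ i → ⟨ g L.* h , (λ j → u (i +ℤ j)) ⟩) ⟩
      ≈⟨ ⟨,⟩-* f (g L.* h) u ⟨
    ⟨ f L.* (g L.* h) , u ⟩ ∎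

  *ᴸ-congˡ : ∀ f {g g′} → g L.≈ g′ → f L.* g L.≈ f L.* g′
  *ᴸ-congˡ f {g} {g′} p k = begin
    coefficient (f L.* g) k                      ≈⟨ coefficient-* f g k ⟩
    ⟨ f , (λ i → coefficient g (-ℤ i +ℤ k)) ⟩    ≈⟨ ⟨,⟩-cong f (λ i → p (-ℤ i +ℤ k)) ⟩
    ⟨ f , (λ i → coefficient g′ (-ℤ i +ℤ k)) ⟩   ≈⟨ coefficient-* f g′ k ⟨
    coefficient (f L.* g′) k                     ∎

  *ᴸ-cong : ∀ {f f′ g g′} → f L.≈ f′ → g L.≈ g′ → f L.* g L.≈ f′ L.* g′
  *ᴸ-cong {f} {f′} {g} {g′} p r k = begin
    coefficient (f L.* g) k     ≈⟨ *ᴸ-congˡ f {g} {g′} r k ⟩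
    coefficient (f L.* g′) k    ≈⟨ *ᴸ-comm f g′ k ⟩
    coefficient (g′ L.* f) k    ≈⟨ *ᴸ-congˡ g′ {f} {f′} p k ⟩
    coefficient (g′ L.* f′) k   ≈⟨ *ᴸ-comm g′ f′ k ⟩
    coefficient (f′ L.* g′) k   ∎

  *ᴸ-identityˡ : ∀ f → L.1# L.* f L.≈ f
  *ᴸ-identityˡ f = ⟨,⟩⇒≈ {L.1# L.* f} {f} λ u → begin
    ⟨ L.1# L.* f , u ⟩                          ≈⟨ ⟨,⟩-* L.1# f u ⟩
    1# * ⟨ f , (λ j → u (0ℤ +ℤ j)) ⟩ + 0#       ≈⟨ trans (+-identityʳ _) (*-identityˡ _) ⟩
    ⟨ f , (λ j → u (0ℤ +ℤ j)) ⟩                 ≈⟨ ⟨,⟩-cong f (λ j → reflexive (≡.cong u (ℤ.+-identityˡ j))) ⟩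
    ⟨ f , u ⟩                                   ∎

  *ᴸ-distribˡ : ∀ f g h → f L.* (g ++ h) L.≈ (f L.* g) ++ (f L.* h)
  *ᴸ-distribˡ f g h = ⟨,⟩⇒≈ {f L.* (g ++ h)} {(f L.* g) ++ (f L.* h)} λ u → begin
    ⟨ f L.* (g ++ h) , u ⟩
      ≈⟨ ⟨,⟩-* f (g ++ h) u ⟩
    ⟨ f , (λ i → ⟨ g ++ h , (λ j → u (i +ℤ j)) ⟩) ⟩
      ≈⟨ ⟨,⟩-cong f (λ i → ⟨,⟩-++ g h (λ j → u (i +ℤ j))) ⟩
    ⟨ f , (λ i → ⟨ g , (λ j → u (i +ℤ j)) ⟩ + ⟨ h , (λ j → u (i +ℤ j)) ⟩) ⟩
      ≈⟨ ⟨,⟩-+ʳ f _ _ ⟩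
    ⟨ f , (λ i → ⟨ g , (λ j → u (i +ℤ j)) ⟩) ⟩ + ⟨ f , (λ i → ⟨ h , (λ j → u (i +ℤ j)) ⟩) ⟩
      ≈⟨ +-cong (⟨,⟩-* f g u) (⟨,⟩-* f h u) ⟨
    ⟨ f L.* g , u ⟩ + ⟨ f L.* h , u ⟩
      ≈⟨ ⟨,⟩-++ (f L.* g) (f L.* h) u ⟨
    ⟨ (f L.* g) ++ (f L.* h) , u ⟩ ∎

  *ᴸ-distribʳ : ∀ f g h → (g ++ h) L.* f L.≈ (g L.* f) ++ (h L.* f)
  *ᴸ-distribʳ f g h k = reflexive (≡.cong (λ e → coefficient e k) (cartesianProductWith-distribʳ-++ _ g h f))

  ++-cong : ∀ {f f′ g g′} → f L.≈ f′ → g L.≈ g′ → f ++ g L.≈ f′ ++ g′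
  ++-cong {f} {f′} {g} {g′} p r k =
    trans (coefficient-++ f g k) (trans (+-cong (p k) (r k)) (sym (coefficient-++ f′ g′ k)))

  ++-comm : ∀ f g → f ++ g L.≈ g ++ f
  ++-comm f g k = trans (coefficient-++ f g k) (trans (+-comm _ _) (sym (coefficient-++ g f k)))

  ++-inverseˡ : ∀ f → (L.- f) ++ f L.≈ []
  ++-inverseˡ f k = trans (coefficient-++ (L.- f) f k) (trans (+-congʳ (coefficient-neg f k)) (-‿inverseˡ _))

  laurentRing : CommutativeRing c ℓ
  laurentRing = record
    { RawRing laurent
    ; isCommutativeRing = record
      { isRing = record
        { +-isAbelianGroup = record
          { isGroup = record
            { isMonoid = record
              { isSemigroup = record
                { isMagma = record
                  { isEquivalence = record
                    { refl  = λ _ → refl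
                    ; sym   = λ p k → sym (p k)
                    ; trans = λ p r k → trans (p k) (r k)
                    }
                  ; ∙-cong = λ {f} {f′} {g} {g′} → ++-cong {f} {f′} {g} {g′}
                  }
                ; assoc = λ f g h k → reflexive (≡.cong (λ e → coefficient e k) (++-assoc f g h))
                }
              ; identity = (λ f k → refl) , (λ f k → reflexive (≡.cong (λ e → coefficient e k) (++-identityʳ f)))
              }
            ; inverse = ++-inverseˡ , (λ f k → trans (++-comm f (L.- f) k) (++-inverseˡ f k))
            ; ⁻¹-cong = λ {f} {g} p k → trans (coefficient-neg f k) (trans (-‿cong (p k)) (sym (coefficient-neg g k)))
            }
          ; comm = ++-comm
          }
        ; *-cong     = λ {f} {f′} {g} {g′} → *ᴸ-cong {f} {f′} {g} {g′}
        ; *-assoc    = *ᴸ-assoc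
        ; *-identity = *ᴸ-identityˡ , (λ f k → trans (*ᴸ-comm f L.1# k) (*ᴸ-identityˡ f k))
        ; distrib    = *ᴸ-distribˡ , *ᴸ-distribʳ
        }
      ; *-comm = *ᴸ-comm
      }
    }

  monomial-cong : ∀ {x y} k → x ≈ y → monomial x k L.≈ monomial y k
  monomial-cong {x} {y} k p = ⟨,⟩⇒≈ {monomial x k} {monomial y k} λ u → +-congʳ (*-congʳ p)

  q^-^ : ∀ k n → (q^ k) L.^ n L.≈ q^ (+ n *ℤ k)
  q^-^ k zero    = λ _ → refl
  q^-^ k (suc n) i = begin
    coefficient ((q^ k) L.* (q^ k) L.^ n) i      ≈⟨ *ᴸ-congˡ (q^ k) {(q^ k) L.^ n} {q^ (+ n *ℤ k)} (q^-^ k n) i ⟩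
    coefficient (monomial (1# * 1#) (k +ℤ + n *ℤ k)) i ≈⟨ monomial-cong (k +ℤ + n *ℤ k) (*-identityˡ 1#) i ⟩
    coefficient (q^ (k +ℤ + n *ℤ k)) i           ≡⟨ ≡.cong (λ j → coefficient (q^ j) i) (ℤ.suc-* (+ n) k) ⟨
    coefficient (q^ (+ suc n *ℤ k)) i            ∎

  constant-+ : ∀ x y → constant x ++ constant y L.≈ constant (x + y)
  constant-+ x y = ⟨,⟩⇒≈ {constant x ++ constant y} {constant (x + y)} λ u →
    trans (sym (+-assoc _ _ _)) (+-congʳ (sym (distribʳ _ _ _)))

  constant-0# : constant 0# L.≈ []
  constant-0# = ⟨,⟩⇒≈ {constant 0#} {[]} λ u → trans (+-identityʳ _) (zeroˡ _)

-- Reciprocals of natural numbers in ℚ.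

open RawSemiringDefs (RawRing.rawSemiring +-*-rawRing) using () renaming (_×_ to _·ℚ_)

-- Addition in `ℚ` reduces fractions, which obstructs computation with a variable `m`. Unnormalised
-- fractions allow an induction that keeps the denominator fixed up to `≃`.
·-reciprocal : ∀ m .{{_ : NonZero m}} → m ·ℚ (+ 1 /ℚ m) ≡ 1ℚ
·-reciprocal m@(suc d) = ℚ.toℚᵘ-injective (ℚᵘ.≃-trans (multiple m)
  (*≡* (≡.trans (ℤ.*-identityʳ (+ m)) (≡.sym (ℤ.*-identityˡ (+ m))))))
  where
  add : ∀ k n → (+ 1 *ℤ n +ℤ k *ℤ n) *ℤ n ≡ (+ 1 +ℤ k) *ℤ (n *ℤ n)
  add = solve-∀

  -- `mkℚᵘ` stores the denominator less one, so the right-hand side is k/m.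
  multiple : ∀ k → toℚᵘ (k ·ℚ (+ 1 /ℚ m)) ≃ mkℚᵘ (+ k) d
  multiple zero    = *≡* ≡.refl
  multiple (suc k) = ℚᵘ.≃-trans (ℚ.toℚᵘ-homo-+ (+ 1 /ℚ m) (k ·ℚ (+ 1 /ℚ m)))
    (ℚᵘ.≃-trans (ℚᵘ.+-cong (ℚ.toℚᵘ-fromℚᵘ (mkℚᵘ (+ 1) d)) (multiple k)) (*≡* (add (+ k) (+ m))))

-- The generating functions of enriched trees and forests.

open IncreasingTrees

module EnrichedTreesProperties {c ℓ} (R : CommutativeRing c ℓ)
  (ι : ℚ → CommutativeRing.Carrier R)
  (ι-mono : RingMorphisms.IsRingMonomorphism +-*-rawRing (CommutativeRing.rawRing R) ι)
  (φ : ℕ → CommutativeRing.Carrier R) where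

  private module R = CommutativeRing R
  open RingMorphisms.IsRingMonomorphism ι-mono using (+-homo; 0#-homo; 1#-homo)
  open RawSemiringDefs (RawRing.rawSemiring R.rawRing) using () renaming (_×_ to _·ᴿ_)
  open EnrichedTrees R ι φ
  open LaurentRing R using (laurentRing; monomial-cong; q^-^; constant-+; constant-0#)
  open CommutativeRing laurentRing hiding (zero)
  open RawSemiringDefs (RawRing.rawSemiring rawRing) using (_^_) renaming (_×_ to _·_)
  open SetoidReasoning setoid
  open HurwitzSeries laurentRing
  open ListSum laurentRing

  κ : ℚ → Laurent
  κ x = constant (ι x)

  ι-· : ∀ m x → m ·ᴿ ι x R.≈ ι (m ·ℚ x)
  ι-· zero    x = R.sym 0#-homo
  ι-· (suc m) x = R.trans (R.+-congˡ (ι-· m x)) (R.sym (+-homo x (m ·ℚ x)))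

  constant-· : ∀ m x → m · constant x ≈ constant (m ·ᴿ x)
  constant-· zero    x = sym {constant R.0#} {[]} constant-0#
  constant-· (suc m) x = begin
    constant x + m · constant x     ≈⟨ +-congˡ {constant x} {m · constant x} {constant (m ·ᴿ x)} (constant-· m x) ⟩
    constant x + constant (m ·ᴿ x)  ≈⟨ constant-+ x (m ·ᴿ x) ⟩
    constant (x R.+ m ·ᴿ x)         ∎

  κ-inverse : ∀ n → (n !) · κ (1/ n !) ≈ 1#
  κ-inverse n = begin
    (n !) · κ (1/ n !)              ≈⟨ constant-· (n !) (ι (1/ n !)) ⟩
    constant ((n !) ·ᴿ ι (1/ n !))  ≈⟨ monomial-cong 0ℤ (ι-· (n !) (1/ n !)) ⟩
    κ ((n !) ·ℚ (1/ n !))           ≡⟨ ≡.cong κ (·-reciprocal (n !) {{n ℕ.!≢0}}) ⟩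
    κ 1ℚ                            ≈⟨ monomial-cong 0ℤ 1#-homo ⟩
    1#                              ∎

  Φ : ℕ → Laurent
  Φ k = constant (φ k)

  q : Laurent
  q = q^ (+ 1)

  open Composition κ κ-inverse
  open Growth laurentRing Φ q
  open TreeSum laurentRing Φ q

  q-^ : ∀ n → q ^ n ≈ q^ (+ n)
  q-^ n = trans {q ^ n} {q^ (+ n *ℤ + 1)} {q^ (+ n)} (q^-^ (+ 1) n) (reflexive (≡.cong q^_ (ℤ.*-identityʳ (+ n))))

  -- Path length is a sum of heights, so its power of q splits into one factor per vertex, as in
  -- `weights`.
  monomial≈weights : ∀ {a} {B : Set a} (d h : B → ℕ) xs →
    monomial (foldr R._*_ R.1# (map (φ ∘ d) xs)) (+ ℕ.sum (map h xs)) ≈ weights (map (λ x → d x , h x) xs)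
  monomial≈weights d h []       = λ _ → R.refl
  monomial≈weights d h (x ∷ xs) = begin
    monomial (φ (d x) R.* y) (+ (h x ℕ.+ s))
      -- Products of monomials compute to one-entry lists; the two sides differ only by the
      -- coefficient `1#` of the power of q.
      ≈⟨ monomial-cong (+ (h x ℕ.+ s)) (R.*-congʳ (R.*-identityʳ (φ (d x)))) ⟨
    (Φ (d x) * q^ (+ h x)) * monomial y (+ s)
      ≈⟨ *-cong {Φ (d x) * q^ (+ h x)} {Φ (d x) * q ^ h x} {monomial y (+ s)} {weights (map (λ x → d x , h x) xs)}
           (*-congˡ {Φ (d x)} {q^ (+ h x)} {q ^ h x} (sym {q ^ h x} {q^ (+ h x)} (q-^ (h x))))
           (monomial≈weights d h xs) ⟩
    (Φ (d x) * q ^ h x) * weights (map (λ x → d x , h x) xs) ∎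
    where
    y = foldr R._*_ R.1# (map (φ ∘ d) xs)
    s = ℕ.sum (map h xs)

  p≈X : ∀ m → p (suc m) ≈ X 0 0 m
  p≈X m = begin
    p (suc m)
      ≈⟨ ∑-cong {g = λ T → monomial (treeWeight T) (+ pathLength T)} {g′ = λ T → weights (vertices T)}
           term (increasingTrees (suc m)) ⟩
    ∑ (λ T → weights (vertices T)) (increasingTrees (suc m))
      ≈⟨ ∑-increasingTrees m ⟩
    X 0 0 m ∎
    where
    term : ∀ T → monomial (treeWeight T) (+ pathLength T) ≈ weights (vertices T)
    term T = trans {monomial (treeWeight T) (+ pathLength T)} {weights (map (vertex T) (allFin (suc m)))} {weights (vertices T)}
      (monomial≈weights _ (height T) (allFin (suc m)))
      (reflexive (≡.cong weights (map-tabulate (λ v → v) (vertex T))))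

  q⁻ⁿ*qⁿ : ∀ n x → q^ (-ℤ (+ n)) * (q ^ n * x) ≈ x
  q⁻ⁿ*qⁿ n x = begin
    q^ (-ℤ (+ n)) * (q ^ n * x)    ≈⟨ *-assoc (q^ (-ℤ (+ n))) (q ^ n) x ⟨
    q^ (-ℤ (+ n)) * q ^ n * x      ≈⟨ *-congʳ {x} {q^ (-ℤ (+ n)) * q ^ n} {1#} inverse ⟩
    1# * x                         ≈⟨ *-identityˡ x ⟩
    x                              ∎
    where
    inverse : q^ (-ℤ (+ n)) * q ^ n ≈ 1#
    inverse = begin
      q^ (-ℤ (+ n)) * q ^ n                           ≈⟨ *-congˡ {q^ (-ℤ (+ n))} {q ^ n} {q^ (+ n)} (q-^ n) ⟩
      monomial (R.1# R.* R.1#) (-ℤ (+ n) +ℤ + n)      ≈⟨ monomial-cong (-ℤ (+ n) +ℤ + n) (R.*-identityˡ R.1#) ⟩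
      q^ (-ℤ (+ n) +ℤ + n)                            ≡⟨ ≡.cong q^_ (ℤ.+-inverseˡ (+ n)) ⟩
      1#                                              ∎

  egfCoefficient-P : D (L.egfCoefficient P) ≐ X 0 0
  egfCoefficient-P n = trans {L.egfCoefficient P (suc n)} {p (suc n)} {X 0 0 n} (egfCoefficient-egf p (suc n)) (p≈X n)

  -- The fixpoint equation reads `p (suc n) ≈ q ^ n * f n`, and q is invertible.
  f-formula : ∀ n → f n ≈ q^ (-ℤ (+ n)) * p (suc n)
  f-formula n = begin
    f n
      ≈⟨ q⁻ⁿ*qⁿ n (f n) ⟨
    q^ (-ℤ (+ n)) * (q ^ n * f n)
      -- `F` is already a composition with `egf κ Φ`, since a product of constants computes to the
      -- constant of the product.
      ≈⟨ *-congˡ {q^ (-ℤ (+ n))} {q ^ n * f n} {q ^ n * composite Φ (L.egfCoefficient P) n}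
           (*-congˡ {q ^ n} {f n} {composite Φ (L.egfCoefficient P) n} (egfCoefficient-compose Φ P n)) ⟩
    q^ (-ℤ (+ n)) * (q ^ n * composite Φ (L.egfCoefficient P) n)
      ≈⟨ *-congˡ {q^ (-ℤ (+ n))} {X 0 0 n} {q ^ n * composite Φ (L.egfCoefficient P) n}
           (X-fixpoint κ κ-inverse (L.egfCoefficient P) (λ _ → R.refl) egfCoefficient-P n) ⟨
    q^ (-ℤ (+ n)) * X 0 0 n
      ≈⟨ *-congˡ {q^ (-ℤ (+ n))} {p (suc n)} {X 0 0 n} (p≈X n) ⟨
    q^ (-ℤ (+ n)) * p (suc n) ∎

  F-formula : F L.≋ L.dilate (q^ -1ℤ) (L.derivative P)
  F-formula n = begin
    F n
      ≈⟨ egf-egfCoefficient F n ⟨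
    κ (1/ n !) * f n
      ≈⟨ *-congˡ {κ (1/ n !)} {f n} {q^ (-ℤ (+ n)) * p (suc n)} (f-formula n) ⟩
    κ (1/ n !) * (q^ (-ℤ (+ n)) * p (suc n))
      ≈⟨ x∙yz≈y∙xz (κ (1/ n !)) (q^ (-ℤ (+ n))) (p (suc n)) ⟩
    q^ (-ℤ (+ n)) * (κ (1/ n !) * p (suc n))
      -- `derivative` reads `P` at positive indices only, where `P` is `egf κ p` by definition.
      ≈⟨ *-cong {(q^ -1ℤ) ^ n} {q^ (-ℤ (+ n))} {L.derivative P n} {κ (1/ n !) * p (suc n)} power (derivative-egf p n) ⟨
    (q^ -1ℤ) ^ n * L.derivative P n ∎
    where
    open import Algebra.Properties.CommutativeSemigroup *-commutativeSemigroup using (x∙yz≈y∙xz)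

    power : (q^ -1ℤ) ^ n ≈ q^ (-ℤ (+ n))
    power = trans {(q^ -1ℤ) ^ n} {q^ (+ n *ℤ -1ℤ)} {q^ (-ℤ (+ n))} (q^-^ -1ℤ n)
      (reflexive (≡.cong q^_ (≡.trans (ℤ.*-comm (+ n) -1ℤ) (ℤ.-1*i≡-i (+ n)))))

corollary1 : ∀ {c ℓ} (R : CommutativeRing c ℓ) →
    let open CommutativeRing R in
    (ι : ℚ → Carrier) → RingMorphisms.IsRingMonomorphism +-*-rawRing rawRing ι →
    (φ : ℕ → Carrier) → ¬ (φ 0 ≈ 0#) →
    let open EnrichedTrees R ι φ in
    (F L.≋ L.dilate (q^ -1ℤ) (L.derivative P)) ×
    (∀ n → f n L.≈ (q^ (-ℤ (+ n))) L.* p (suc n))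
corollary1 R ι ι-mono φ _ = F-formula , f-formula
  where open EnrichedTreesProperties R ι ι-mono φ
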